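{- The following twelve mesh patterns $(12,R)$ are pairwise equidistributed, where $R$ ranges over: $\{(1,2),(2,2),(0,1)\}$, $\{(1,2),(0,1),(0,0)\}$, $\{(2,2),(2,1),(1,0)\}$, $\{(2,1),(1,0),(0,0)\}$, $\{(2,2),(0,1),(1,1)\}$, $\{(1,2),(1,1),(0,0)\}$, $\{(1,1),(2,1),(0,0)\}$, $\{(2,2),(1,1),(1,0)\}$, $\{(1,2),(2,2),(0,0)\}$, $\{(2,2),(0,1),(0,0)\}$, $\{(2,2),(2,1),(0,0)\}$, $\{(2,2),(0,0),(1,0)\}$.
   Context: For $R\subseteq\{0,1,2\}^2$ and $\pi=\pi_1\cdots\pi_n\in S_n$, an occurrence of the mesh pattern $(12,R)$ in $\pi$ is a pair of positions $i_1<i_2$ with $\pi_{i_1}<\pi_{i_2}$ such that, setting $x_0=0,x_1=i_1,x_2=i_2,x_3=n+1$ and $y_0=0,y_1=\pi_{i_1},y_2=\pi_{i_2},y_3=n+1$, for every $(a,b)\in R$ there is no index $k$ with $x_a<k<x_{a+1}$ and $y_b<\pi_k<y_{b+1}$. $s_{n,k}(p)$ is the number of $\pi\in S_n$ with exactly $k$ occurrences of $p$; $p_1,p_2$ are equidistributed if $s_{n,k}(p_1)=s_{n,k}(p_2)$ for all $n,k\ge 0$. -}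

module Defs where

open import Data.Nat using (ℕ; zero; suc; _+_; _<ᵇ_)
open import Data.Bool using (Bool; true; false; _∧_; _∨_; not; if_then_else_)
open import Data.List using (List; []; _∷_; length; concatMap; map; upTo; allFin)
open import Data.Fin using (Fin; toℕ; zero; suc)
open import Data.Product using (_×_; _,_)
open import Relation.Binary.PropositionalEquality using (_≡_)

-- A permutation π = π₁⋯πₙ of {1,…,n} in one-line notation (a list of ℕ).
-- All permutations of {1..n}: insert n into every position of each
-- permutation of {1..n-1}.
insertions : ℕ → List ℕ → List (List ℕ)
insertions x []       = (x ∷ []) ∷ []
insertions x (y ∷ ys) = (x ∷ y ∷ ys) ∷ map (y ∷_) (insertions x ys)

perms : ℕ → List (List ℕ)
perms zero    = [] ∷ []
perms (suc n) = concatMap (insertions (suc n)) (perms n)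

-- 1-based lookup (returns 0 out of range; never used out of range)
at : List ℕ → ℕ → ℕ
at []       _             = 0
at (x ∷ xs) zero          = 0
at (x ∷ xs) (suc zero)    = x
at (x ∷ xs) (suc (suc i)) = at xs (suc i)

positions : ℕ → List ℕ
positions n = map suc (upTo n)

anyᵇ : {A : Set} → (A → Bool) → List A → Bool
anyᵇ p []       = false
anyᵇ p (x ∷ xs) = p x ∨ anyᵇ p xs

allᵇ : {A : Set} → (A → Bool) → List A → Bool
allᵇ p []       = true
allᵇ p (x ∷ xs) = p x ∧ allᵇ p xs

-- a mesh-pattern shading R ⊆ {0,1,2}², given as a list of boxes (a,b)
Box : Set
Box = Fin 3 × Fin 3

pick : Fin 3 → ℕ → ℕ → ℕ → ℕ → ℕ
pick zero             z₀ z₁ z₂ z₃ = z₀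
pick (Fin.suc zero)   z₀ z₁ z₂ z₃ = z₁
pick (suc (suc _)) z₀ z₁ z₂ z₃ = z₂

pick′ : Fin 3 → ℕ → ℕ → ℕ → ℕ → ℕ
pick′ zero             z₀ z₁ z₂ z₃ = z₁
pick′ (Fin.suc zero)   z₀ z₁ z₂ z₃ = z₂
pick′ (suc (suc _)) z₀ z₁ z₂ z₃ = z₃

boxEmpty : List ℕ → ℕ → ℕ → Box → Bool
boxEmpty π i₁ i₂ (a , b) =
  not (anyᵇ (λ k → (xa <ᵇ k) ∧ (k <ᵇ xa′) ∧ (yb <ᵇ at π k) ∧ (at π k <ᵇ yb′))
           (positions n))
  where
  n   = length π
  xa  = pick  a 0 i₁ i₂ (suc n)
  xa′ = pick′ a 0 i₁ i₂ (suc n)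
  yb  = pick  b 0 (at π i₁) (at π i₂) (suc n)
  yb′ = pick′ b 0 (at π i₁) (at π i₂) (suc n)

isOcc : List Box → List ℕ → ℕ → ℕ → Bool
isOcc R π i₁ i₂ = (i₁ <ᵇ i₂) ∧ (at π i₁ <ᵇ at π i₂) ∧ allᵇ (boxEmpty π i₁ i₂) R

occ : List Box → List ℕ → ℕ
occ R π = length (concatMap (λ i₁ → filter′ i₁ (positions (length π))) (positions (length π)))
  where
  filter′ : ℕ → List ℕ → List ℕ
  filter′ i₁ []       = []
  filter′ i₁ (j ∷ js) = if isOcc R π i₁ j then j ∷ filter′ i₁ js else filter′ i₁ js

_≡ᵇ_ : ℕ → ℕ → Bool
zero  ≡ᵇ zero  = true
suc m ≡ᵇ suc n = m ≡ᵇ n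
_     ≡ᵇ _     = false

s : ℕ → ℕ → List Box → ℕ
s n k R = length (filterᵇ (λ π → occ R π ≡ᵇ k) (perms n))
  where
  filterᵇ : (List ℕ → Bool) → List (List ℕ) → List (List ℕ)
  filterᵇ p []       = []
  filterᵇ p (x ∷ xs) = if p x then x ∷ filterᵇ p xs else filterᵇ p xs

Equidistributed : List Box → List Box → Set
Equidistributed R₁ R₂ = ∀ n k → s n k R₁ ≡ s n k R₂

b0 b1 b2 : Fin 3
b0 = zero
b1 = suc zero
b2 = suc (suc zero)

twelve : List (List Box)
twelve = ((b1 , b2) ∷ (b2 , b2) ∷ (b0 , b1) ∷ []) ∷ ((b1 , b2) ∷ (b0 , b1) ∷ (b0 , b0) ∷ []) ∷ ((b2 , b2) ∷ (b2 , b1) ∷ (b1 , b0) ∷ []) ∷ ((b2 , b1) ∷ (b1 , b0) ∷ (b0 , b0) ∷ []) ∷ ((b2 , b2) ∷ (b0 , b1) ∷ (b1 , b1) ∷ []) ∷ ((b1 , b2) ∷ (b1 , b1) ∷ (b0 , b0) ∷ []) ∷ ((b1 , b1) ∷ (b2 , b1) ∷ (b0 , b0) ∷ []) ∷ ((b2 , b2) ∷ (b1 , b1) ∷ (b1 , b0) ∷ []) ∷ ((b1 , b2) ∷ (b2 , b2) ∷ (b0 , b0) ∷ []) ∷ ((b2 , b2) ∷ (b0 , b1) ∷ (b0 , b0) ∷ []) ∷ ((b2 , b2) ∷ (b2 , b1) ∷ (b0 , b0) ∷ []) ∷ ((b2 , b2) ∷ (b0 , b0) ∷ (b1 , b0)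 ∷ []) ∷ []

{-# OPTIONS --safe #-}
module Submission where

-- The symmetries of the square that fix 12 (rotation by 180°, i.e. reverse-complement, and
-- transposition, i.e. inverse) reduce the twelve patterns to three: numbers 4, 5 and 12.
-- In each of these an occurrence is determined by its upper point j. For numbers 5 and 12
-- the upper points are the right-to-left maxima that are not left-to-right minima. For
-- number 4, π_j must exceed the minimum m of the preceding entries and be the least among the
-- entries above m not yet read when π is read from left to right; for number 12 it must be the
-- greatest of them. As in the Simion–Schmidt bijection, replacing at each step the r-th
-- smallest available entry above m by the r-th largest exchanges the two conditions.

open import Defs
open import Data.Bool using (Bool; true; false; T; not; _∧_)
open import Data.Bool.Properties using (T?; T-∧)
open import Data.Empty using (⊥; ⊥-elim)
open import Data.Fin using (Fin; opposite)
import Data.Fin.Properties as Fin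
open import Data.List
  using (List; []; _∷_; _++_; length; map; filter; concatMap; upTo; applyUpTo; cartesianProduct)
import Data.List.Extrema.Nat as Extrema
import Data.List.Membership.DecPropositional as DecMembership
open import Data.List.Membership.Propositional using (_∈_; _∉_)
open import Data.List.Membership.Propositional.Properties
open import Data.List.Properties
  using (length-map; length-upTo; length-++; length-++-sucʳ; concatMap-cong; filter-++;
         ∷-injective; ∷-injectiveʳ; ++-assoc; ++-identityʳ; ++-conicalˡ; ++-conicalʳ)
open import Data.List.Relation.Binary.Disjoint.Propositional using (Disjoint)
open import Data.List.Relation.Binary.Permutation.Propositional
  using (_↭_; ↭-refl; ↭-sym; ↭-trans; ↭-reflexive; ↭⇒↭ₛ; prep)
open import Data.List.Relation.Binary.Permutation.Propositional.Properties
  using (↭-length; ↭-empty-inv; ∈-resp-↭; shift; drop-mid)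
import Data.List.Relation.Binary.Permutation.Setoid.Properties as SetoidPermutation
open import Data.List.Relation.Unary.All as All using (All; []; _∷_; all?)
open import Data.List.Relation.Unary.AllPairs using (AllPairs; []; _∷_)
import Data.List.Relation.Unary.AllPairs.Properties as AllPairs
open import Data.List.Relation.Unary.Any using (here; there)
open import Data.List.Relation.Unary.Unique.Propositional using (Unique)
import Data.List.Relation.Unary.Unique.Propositional.Properties as Unique
open import Data.Nat hiding (_≡ᵇ_)
open import Data.Nat.Properties
open import Data.Product as Product using (_×_; _,_; proj₁; proj₂; ∃; ∃₂)
open import Data.Product.Properties using () renaming (≡-dec to ×-≡-dec)
open import Data.Sum using (inj₁; inj₂)
open import Data.Unit using (tt)
open import Function using (_∘_; id; case_of_; Equivalence)
open import Relation.Binary.Definitions using (tri<; tri≈; tri>)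
open import Relation.Binary.PropositionalEquality
open import Relation.Nullary using (¬_; Dec; yes; no)
open import Relation.Nullary.Decidable using (True; toWitness)

-- Counting by injections

-- Both the permutations with a given count and the occurrences in one permutation are compared
-- through relations that are total and injective; each gives one inequality. Reverse-complement,
-- inverse and rank reversal are symmetric as relations, so the other inequality follows from the
-- same lemma and no inverse map has to be constructed. The obstacle in the rank reversal is that
-- the values available above `m` soon differ between the two permutations. Their number stays
-- equal, which is all that ranks require, and the values below `m` stay the same: a new minimum is
-- copied, and the unread values between it and the old minimum join the available ones on both
-- sides. Having no smaller available value then corresponds to having no larger one. The upper
-- point determines an occurrence because the shading fixes the lower point: for numbers 4 and 12 it
-- is the minimum of the preceding entries, for number 5 the greatest preceding entry below the
-- upper point.

∈-remove : ∀ {A : Set} {x y : A} xs {ys} → x ∈ xs ++ y ∷ ys → x ≢ y → x ∈ xs ++ ys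
∈-remove xs x∈ x≢y with ∈-++⁻ xs x∈
... | inj₁ x∈xs         = ∈-++⁺ˡ x∈xs
... | inj₂ (here x≡y)   = ⊥-elim (x≢y x≡y)
... | inj₂ (there x∈ys) = ∈-++⁺ʳ xs x∈ys

-- A relation in place of a function lets a correspondence be given by its defining property. The
-- partner of the head is deleted from `ys`; injectivity keeps the partners of the tail away from
-- it.
injection⇒length≤ : ∀ {A B : Set} (_~_ : A → B → Set) {xs : List A} {ys : List B} →
  Unique xs →
  (∀ {x} → x ∈ xs → ∃ λ y → y ∈ ys × x ~ y) →
  (∀ {x x′ y} → x ∈ xs → x′ ∈ xs → x ~ y → x′ ~ y → x ≡ x′) →
  length xs ≤ length ys
injection⇒length≤ _~_ [] total injective = z≤n
injection⇒length≤ _~_ {x ∷ xs} (x∉xs ∷ xs!) total injective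
  with y , y∈ys , x~y ← total (here refl)
  with ys₁ , ys₂ , refl ← ∈-∃++ y∈ys =
  subst (suc (length xs) ≤_) (sym (length-++-sucʳ ys₁ y ys₂))
    (s≤s (injection⇒length≤ _~_ xs! total′ (λ p q → injective (there p) (there q))))
  where
  total′ : ∀ {z} → z ∈ xs → ∃ λ w → w ∈ ys₁ ++ ys₂ × z ~ w
  total′ z∈xs with w , w∈ys , z~w ← total (there z∈xs) =
    w , ∈-remove ys₁ w∈ys (λ { refl →
          All.lookup x∉xs z∈xs (injective (here refl) (there z∈xs) x~y z~w) }) , z~w

-- Deleting from `ys` an occurrence of the head of `xs` preserves the hypotheses: by uniqueness the
-- tail never meets that value, and both lengths drop by one.
⊆∧length≡⇒↭ : ∀ {A : Set} {xs ys : List A} → Unique xs →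
  (∀ {x} → x ∈ xs → x ∈ ys) → length xs ≡ length ys → xs ↭ ys
⊆∧length≡⇒↭ {xs = []} {[]} [] xs⊆ys eq = ↭-refl
⊆∧length≡⇒↭ {xs = x ∷ xs} (x∉xs ∷ xs!) xs⊆ys eq
  with ys₁ , ys₂ , refl ← ∈-∃++ (xs⊆ys (here refl)) =
  ↭-trans
    (prep x (⊆∧length≡⇒↭ xs!
      (λ z∈xs → ∈-remove ys₁ (xs⊆ys (there z∈xs)) (λ { refl → All.lookup x∉xs z∈xs refl }))
      (suc-injective (trans eq (length-++-sucʳ ys₁ x ys₂)))))
    (↭-sym (shift x ys₁ ys₂))

Unique-resp-↭ : ∀ {A : Set} {xs ys : List A} → xs ↭ ys → Unique xs → Unique ys
Unique-resp-↭ {A} = SetoidPermutation.Unique-resp-↭ (setoid A) ∘ ↭⇒↭ₛ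

Unique-map : ∀ {A B : Set} {f : A → B} {xs} →
  (∀ {x y} → x ∈ xs → y ∈ xs → f x ≡ f y → x ≡ y) → Unique xs → Unique (map f xs)
Unique-map injective [] = []
Unique-map {f = f} injective (x∉xs ∷ xs!) =
  All.tabulate (λ z∈ fx≡z → case ∈-map⁻ f z∈ of λ where
    (y , y∈xs , refl) → All.lookup x∉xs y∈xs (injective (here refl) (there y∈xs) fx≡z))
  ∷ Unique-map (λ p q → injective (there p) (there q)) xs!

-- Permutations in one-line notation

infix 4 _∈[1⋯_]

_∈[1⋯_] : ℕ → ℕ → Set
k ∈[1⋯ n ] = 1 ≤ k × k ≤ n

∈-positions⁺ : ∀ {n k} → k ∈[1⋯ n ] → k ∈ positions n
∈-positions⁺ {k = suc k} (_ , k<n) = ∈-map⁺ suc (∈-upTo⁺ k<n)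

∈-positions⁻ : ∀ {n k} → k ∈ positions n → k ∈[1⋯ n ]
∈-positions⁻ k∈ with _ , i∈ , refl ← ∈-map⁻ suc k∈ = s≤s z≤n , ∈-upTo⁻ i∈

positions-unique : ∀ n → Unique (positions n)
positions-unique n = Unique.map⁺ suc-injective (Unique.upTo⁺ n)

length-positions : ∀ n → length (positions n) ≡ n
length-positions n = trans (length-map suc (upTo n)) (length-upTo n)

Perm : ℕ → List ℕ → Set
Perm n π = π ↭ positions n

positions-suc-↭ : ∀ n → suc n ∷ positions n ↭ positions (suc n)
positions-suc-↭ n = ⊆∧length≡⇒↭
  (All.tabulate (λ k∈ → λ { refl → 1+n≰n (proj₂ (∈-positions⁻ k∈)) }) ∷ positions-unique n)
  (λ { (here refl) → ∈-positions⁺ (s≤s z≤n , ≤-refl)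
     ; (there k∈)  → ∈-positions⁺ (Product.map₂ m≤n⇒m≤1+n (∈-positions⁻ k∈)) })
  (trans (cong suc (length-positions n)) (sym (length-positions (suc n))))

∈-insertions⁻ : ∀ {x ρ} π → ρ ∈ insertions x π → ∃₂ λ xs ys → π ≡ xs ++ ys × ρ ≡ xs ++ x ∷ ys
∈-insertions⁻ []      (here refl) = [] , [] , refl , refl
∈-insertions⁻ (y ∷ π) (here refl) = [] , y ∷ π , refl , refl
∈-insertions⁻ (y ∷ π) (there ρ∈)
  with _ , ρ′∈ , refl ← ∈-map⁻ (y ∷_) ρ∈
  with xs , ys , refl , refl ← ∈-insertions⁻ π ρ′∈ = y ∷ xs , ys , refl , refl

∈-insertions⁺ : ∀ x xs {ys} → xs ++ x ∷ ys ∈ insertions x (xs ++ ys)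
∈-insertions⁺ x []       {[]}    = here refl
∈-insertions⁺ x []       {_ ∷ _} = here refl
∈-insertions⁺ x (y ∷ xs) = there (∈-map⁺ (y ∷_) (∈-insertions⁺ x xs))

insertions-unique : ∀ {x} π → x ∉ π → Unique (insertions x π)
insertions-unique []      x∉π = [] ∷ []
insertions-unique (y ∷ π) x∉π =
  All.tabulate (λ ρ∈ eq → case ∈-map⁻ (y ∷_) ρ∈ of λ where
    (_ , _ , refl) → x∉π (here (proj₁ (∷-injective eq))))
  ∷ Unique.map⁺ ∷-injectiveʳ (insertions-unique π (x∉π ∘ there))

-- Both cuts are made at the first occurrence of `x`.
split-unique : ∀ {A : Set} {x : A} as {bs} cs {ds} → x ∉ as → x ∉ cs →
  as ++ x ∷ bs ≡ cs ++ x ∷ ds → as ≡ cs × bs ≡ ds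
split-unique []       []       _    _    refl = refl , refl
split-unique []       (c ∷ cs) _    x∉cs refl = ⊥-elim (x∉cs (here refl))
split-unique (a ∷ as) []       x∉as _    refl = ⊥-elim (x∉as (here refl))
split-unique (a ∷ as) (c ∷ cs) x∉as x∉cs eq
  with refl , eq′ ← ∷-injective eq
  with refl , refl ← split-unique as cs (x∉as ∘ there) (x∉cs ∘ there) eq′ = refl , refl

-- Removing the fresh value `x` from a common result would recover both `π` and `ρ`.
insertions-disjoint : ∀ {x} π ρ → x ∉ π → x ∉ ρ → π ≢ ρ → Disjoint (insertions x π) (insertions x ρ)
insertions-disjoint π ρ x∉π x∉ρ π≢ρ (σ∈ , σ∈′)
  with as , bs , refl , refl ← ∈-insertions⁻ π σ∈
  with cs , ds , refl , eq ← ∈-insertions⁻ ρ σ∈′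
  with refl , refl ← split-unique as cs (x∉π ∘ ∈-++⁺ˡ) (x∉ρ ∘ ∈-++⁺ˡ) eq = π≢ρ refl

∈-perms⁻ : ∀ n {π} → π ∈ perms n → Perm n π
∈-perms⁻ zero    (here refl) = ↭-refl
∈-perms⁻ (suc n) π∈
  with ρs , π∈ρs , ρs∈ ← ∈-concat⁻′ (map (insertions (suc n)) (perms n)) π∈
  with ρ , ρ∈ , refl ← ∈-map⁻ (insertions (suc n)) ρs∈
  with xs , ys , refl , refl ← ∈-insertions⁻ ρ π∈ρs =
  ↭-trans (shift (suc n) xs ys) (↭-trans (prep _ (∈-perms⁻ n ρ∈)) (positions-suc-↭ n))

∈-perms⁺ : ∀ n {π} → Perm n π → π ∈ perms n
∈-perms⁺ zero    {[]}    π↭ = here refl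
∈-perms⁺ zero    {_ ∷ _} π↭ with () ← ↭-length π↭
∈-perms⁺ (suc n) π↭
  with xs , ys , refl ← ∈-∃++ (∈-resp-↭ (↭-sym π↭) (∈-positions⁺ (s≤s z≤n , ≤-refl))) =
  ∈-concat⁺′ (∈-insertions⁺ (suc n) xs)
    (∈-map⁺ (insertions (suc n))
      (∈-perms⁺ n (drop-mid xs [] (↭-trans π↭ (↭-sym (positions-suc-↭ n))))))

perms-unique : ∀ n → Unique (perms n)
perms-unique zero    = [] ∷ []
perms-unique (suc n) = concatInsertions (perms n) (perms-unique n) fresh
  where
  fresh : ∀ {π} → π ∈ perms n → suc n ∉ π
  fresh π∈ m∈ = 1+n≰n (proj₂ (∈-positions⁻ (∈-resp-↭ (∈-perms⁻ n π∈) m∈)))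

  concatInsertions : ∀ {x} πs → Unique πs → (∀ {π} → π ∈ πs → x ∉ π) →
    Unique (concatMap (insertions x) πs)
  concatInsertions []       _            _  = []
  concatInsertions (π ∷ πs) (π∉πs ∷ πs!) x∉ =
    Unique.++⁺ (insertions-unique π (x∉ (here refl))) (concatInsertions πs πs! (x∉ ∘ there))
      λ { (ρ∈ , ρ∈′) → case ∈-concat⁻′ (map (insertions _) πs) ρ∈′ of λ where
        (_ , ρ∈ρs , ρs∈) → case ∈-map⁻ (insertions _) ρs∈ of λ where
          (σ , σ∈ , refl) → insertions-disjoint π σ (x∉ (here refl)) (x∉ (there σ∈))
                              (All.lookup π∉πs σ∈) (ρ∈ , ρ∈ρs) }

at-∈ : ∀ xs {k} → k ∈[1⋯ length xs ] → at xs k ∈ xs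
at-∈ (x ∷ xs) {suc zero}    _         = here refl
at-∈ (x ∷ xs) {suc (suc k)} (_ , k≤n) = there (at-∈ xs (s≤s z≤n , s≤s⁻¹ k≤n))
at-∈ []       {suc _}       (_ , ())
at-∈ (_ ∷ _)  {zero}        (() , _)

at-injective : ∀ {xs} → Unique xs → ∀ {i j} → i ∈[1⋯ length xs ] → j ∈[1⋯ length xs ] →
  at xs i ≡ at xs j → i ≡ j
at-injective {x ∷ xs} (x∉xs ∷ xs!) {suc zero}    {suc zero}    _ _ _ = refl
at-injective {x ∷ xs} (x∉xs ∷ xs!) {suc zero}    {suc (suc j)} _ (_ , j≤n) eq =
  ⊥-elim (All.lookup x∉xs (at-∈ xs (s≤s z≤n , s≤s⁻¹ j≤n)) eq)
at-injective {x ∷ xs} (x∉xs ∷ xs!) {suc (suc i)} {suc zero}    (_ , i≤n) _ eq =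
  ⊥-elim (All.lookup x∉xs (at-∈ xs (s≤s z≤n , s≤s⁻¹ i≤n)) (sym eq))
at-injective {x ∷ xs} (x∉xs ∷ xs!) {suc (suc i)} {suc (suc j)} (_ , i≤n) (_ , j≤n) eq =
  cong suc (at-injective xs! (s≤s z≤n , s≤s⁻¹ i≤n) (s≤s z≤n , s≤s⁻¹ j≤n) eq)
at-injective {[]} _ {zero} (() , _)
at-injective {[]} _ {suc _} (_ , ())
at-injective {_ ∷ _} _ {zero} (() , _)
at-injective {_ ∷ _} _ {suc _} {zero} _ (() , _)

at-ext : ∀ {xs ys} → length xs ≡ length ys →
  (∀ {k} → k ∈[1⋯ length xs ] → at xs k ≡ at ys k) → xs ≡ ys
at-ext {[]}     {[]}     _  _  = refl
at-ext {x ∷ xs} {y ∷ ys} eq pt = cong₂ _∷_ (pt (s≤s z≤n , s≤s z≤n))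
  (at-ext (suc-injective eq) λ { {suc k} (_ , k≤n) → pt {suc (suc k)} (s≤s z≤n , s≤s k≤n) })

at-map : ∀ f xs {k} → k ∈[1⋯ length xs ] → at (map f xs) k ≡ f (at xs k)
at-map f (x ∷ xs) {suc zero}    _         = refl
at-map f (x ∷ xs) {suc (suc k)} (_ , k≤n) = at-map f xs (s≤s z≤n , s≤s⁻¹ k≤n)
at-map f []       {suc _}       (_ , ())
at-map f (_ ∷ _)  {zero}        (() , _)

at-applyUpTo : ∀ f n {k} → k < n → at (applyUpTo f n) (suc k) ≡ f k
at-applyUpTo f (suc n) {zero}  _   = refl
at-applyUpTo f (suc n) {suc k} k<n = at-applyUpTo (f ∘ suc) n (s≤s⁻¹ k<n)

at-positions : ∀ n {k} → k ∈[1⋯ n ] → at (positions n) k ≡ k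
at-positions n {suc k} k∈@(_ , k<n) =
  trans (at-map suc (upTo n) (subst (suc k ∈[1⋯_]) (sym (length-upTo n)) k∈))
        (cong suc (at-applyUpTo id n k<n))

at-map-positions : ∀ f n {k} → k ∈[1⋯ n ] → at (map f (positions n)) k ≡ f k
at-map-positions f n {k} k∈ =
  trans (at-map f (positions n) (subst (k ∈[1⋯_]) (sym (length-positions n)) k∈))
        (cong f (at-positions n k∈))

index : List ℕ → ℕ → ℕ
index []       v = zero
index (x ∷ xs) v with x ≟ v
... | yes _ = 1
... | no  _ = suc (index xs v)

index-∈ : ∀ {xs v} → v ∈ xs → index xs v ∈[1⋯ length xs ]
index-∈ {x ∷ xs} {v} v∈ with x ≟ v | v∈
... | yes _  | _           = s≤s z≤n , s≤s z≤n
... | no x≢v | here refl   = ⊥-elim (x≢v refl)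
... | no _   | there v∈xs  = s≤s z≤n , s≤s (proj₂ (index-∈ v∈xs))

at-index : ∀ {xs v} → v ∈ xs → at xs (index xs v) ≡ v
at-index {x ∷ xs} {v} v∈ with x ≟ v | v∈
... | yes x≡v | _          = x≡v
... | no x≢v  | here refl  = ⊥-elim (x≢v refl)
... | no _    | there v∈xs with index xs v | index-∈ v∈xs | at-index v∈xs
...   | suc _ | _ | eq = eq

module _ {n π} (π↭ : Perm n π) where

  Perm-length : length π ≡ n
  Perm-length = trans (↭-length π↭) (length-positions n)

  Perm-unique : Unique π
  Perm-unique = Unique-resp-↭ (↭-sym π↭) (positions-unique n)

  Perm-∈ : ∀ {v} → v ∈[1⋯ n ] → v ∈ π
  Perm-∈ v∈ = ∈-resp-↭ (↭-sym π↭) (∈-positions⁺ v∈)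

  at-range : ∀ {k} → k ∈[1⋯ n ] → at π k ∈[1⋯ n ]
  at-range k∈ = ∈-positions⁻ (∈-resp-↭ π↭ (at-∈ π (subst (_ ∈[1⋯_]) (sym Perm-length) k∈)))

  Perm-injective : ∀ {i j} → i ∈[1⋯ n ] → j ∈[1⋯ n ] → at π i ≡ at π j → i ≡ j
  Perm-injective i∈ j∈ = at-injective Perm-unique
    (subst (_ ∈[1⋯_]) (sym Perm-length) i∈) (subst (_ ∈[1⋯_]) (sym Perm-length) j∈)

Perm-ext : ∀ {n π ρ} → Perm n π → Perm n ρ →
  (∀ {k} → k ∈[1⋯ n ] → at π k ≡ at ρ k) → π ≡ ρ
Perm-ext π↭ ρ↭ pt = at-ext (trans (Perm-length π↭) (sym (Perm-length ρ↭)))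
  (λ k∈ → pt (subst (_ ∈[1⋯_]) (Perm-length π↭) k∈))

Perm-tabulate : ∀ {n f} → (∀ {k} → k ∈[1⋯ n ] → f k ∈[1⋯ n ]) →
  (∀ {i j} → i ∈[1⋯ n ] → j ∈[1⋯ n ] → f i ≡ f j → i ≡ j) → Perm n (map f (positions n))
Perm-tabulate {n} {f} range injective = ⊆∧length≡⇒↭
  (Unique-map (λ p q → injective (∈-positions⁻ p) (∈-positions⁻ q)) (positions-unique n))
  (λ v∈ → case ∈-map⁻ f v∈ of λ where (_ , k∈ , refl) → ∈-positions⁺ (range (∈-positions⁻ k∈)))
  (length-map f (positions n))

-- The counts s and occ as lengths of filtered lists

-- The left-hand side is the filter defined locally in s; it cannot be named here and is
-- inferred from the use in s≡length-filter. Likewise filter′≡filter below.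
filterᵇ-length : ∀ n k R πs → _ ≡ length (filter (λ π → T? (occ R π ≡ᵇ k)) πs)

s≡length-filter : ∀ n k R → s n k R ≡ length (filter (λ π → T? (occ R π ≡ᵇ k)) (perms n))
-- Once `perms n` is abstracted to a variable, the unknown left-hand side is applied to distinct
-- variables only and unification can solve it.
s≡length-filter n k R with perms n
... | πs = filterᵇ-length n k R πs

filterᵇ-length n k R []       = refl
filterᵇ-length n k R (π ∷ πs) with occ R π ≡ᵇ k
... | true  = cong suc (filterᵇ-length n k R πs)
... | false = filterᵇ-length n k R πs

isOcc? : ∀ R π (ij : ℕ × ℕ) → Dec (T (isOcc R π (proj₁ ij) (proj₂ ij)))
isOcc? R π (i , j) = T? (isOcc R π i j)

filter′≡filter : ∀ R π i js → _ ≡ filter (λ j → T? (isOcc R π i j)) js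

occ≡length-concatMap : ∀ R π → let ps = positions (length π) in
  occ R π ≡ length (concatMap (λ i → filter (λ j → T? (isOcc R π i j)) ps) ps)
occ≡length-concatMap R π with positions (length π)
... | ps = cong length (concatMap-cong (λ i → filter′≡filter R π i ps) ps)

filter′≡filter R π i [] = refl
filter′≡filter R π i (j ∷ js) with isOcc R π i j
... | true  = cong (j ∷_) (filter′≡filter R π i js)
... | false = filter′≡filter R π i js

occurrences : List Box → List ℕ → List (ℕ × ℕ)
occurrences R π = let ps = positions (length π) in filter (isOcc? R π) (cartesianProduct ps ps)

occ≡length-occurrences : ∀ R π → occ R π ≡ length (occurrences R π)
occ≡length-occurrences R π = trans (occ≡length-concatMap R π) (rows ps)
  where
  ps = positions (length π)

  row : ∀ i js → length (filter (λ j → T? (isOcc R π i j)) js) ≡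
                 length (filter (isOcc? R π) (map (i ,_) js))
  row i [] = refl
  row i (j ∷ js) with isOcc R π i j
  ... | true  = cong suc (row i js)
  ... | false = row i js

  rows : ∀ is → length (concatMap (λ i → filter (λ j → T? (isOcc R π i j)) ps) is) ≡
                length (filter (isOcc? R π) (cartesianProduct is ps))
  rows [] = refl
  rows (i ∷ is) = begin
    length (filter _ ps ++ concatMap (λ i → filter _ ps) is)
      ≡⟨ length-++ (filter _ ps) ⟩
    length (filter _ ps) + length (concatMap (λ i → filter _ ps) is)
      ≡⟨ cong₂ _+_ (row i ps) (rows is) ⟩
    length (filter (isOcc? R π) (map (i ,_) ps)) + length (filter (isOcc? R π) (cartesianProduct is ps))
      ≡⟨ length-++ (filter (isOcc? R π) (map (i ,_) ps)) ⟨
    length (filter (isOcc? R π) (map (i ,_) ps) ++ filter (isOcc? R π) (cartesianProduct is ps))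
      ≡⟨ cong length (filter-++ (isOcc? R π) (map (i ,_) ps) (cartesianProduct is ps)) ⟨
    length (filter (isOcc? R π) (cartesianProduct (i ∷ is) ps)) ∎
    where open ≡-Reasoning

occurrences-unique : ∀ R π → Unique (occurrences R π)
occurrences-unique R π = Unique.filter⁺ (isOcc? R π)
  (Unique.cartesianProduct⁺ (positions-unique (length π)) (positions-unique (length π)))

-- Gap a n u v k: k lies strictly between x_a and x_{a+1} where (x₀,x₁,x₂,x₃) = (0,u,v,n+1).
Gap : Fin 3 → ℕ → ℕ → ℕ → ℕ → Set
Gap a n u v k = pick a 0 u v (suc n) < k × k < pick′ a 0 u v (suc n)

-- Occurrences as propositions, and comparison of counts.

record Occ (R : List Box) (n : ℕ) (π : List ℕ) (i j : ℕ) : Set where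
  field
    1≤i   : 1 ≤ i
    i<j   : i < j
    j≤n   : j ≤ n
    rise  : at π i < at π j
    clear : ∀ {a b} → (a , b) ∈ R → ∀ {k} → k ∈[1⋯ n ] →
            Gap a n i j k → Gap b n (at π i) (at π j) (at π k) → ⊥

  i∈ : i ∈[1⋯ n ]
  i∈ = 1≤i , ≤-trans (<⇒≤ i<j) j≤n

  j∈ : j ∈[1⋯ n ]
  j∈ = ≤-trans 1≤i (<⇒≤ i<j) , j≤n

T-∧⁻ : ∀ {x y} → T (x ∧ y) → T x × T y
T-∧⁻ = Equivalence.to T-∧

T-∧⁺ : ∀ {x y} → T x → T y → T (x ∧ y)
T-∧⁺ p q = Equivalence.from T-∧ (p , q)

T-allᵇ⁻ : ∀ {A : Set} {p : A → Bool} {x} xs → T (allᵇ p xs) → x ∈ xs → T (p x)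
T-allᵇ⁻ (x ∷ xs) all (here refl)  = proj₁ (T-∧⁻ all)
T-allᵇ⁻ (x ∷ xs) all (there x∈xs) = T-allᵇ⁻ xs (proj₂ (T-∧⁻ all)) x∈xs

T-allᵇ⁺ : ∀ {A : Set} {p : A → Bool} xs → (∀ {x} → x ∈ xs → T (p x)) → T (allᵇ p xs)
T-allᵇ⁺ []       all = tt
T-allᵇ⁺ (x ∷ xs) all = T-∧⁺ (all (here refl)) (T-allᵇ⁺ xs (all ∘ there))

T-not-anyᵇ⁻ : ∀ {A : Set} {p : A → Bool} {x} xs → T (not (anyᵇ p xs)) → x ∈ xs → ¬ T (p x)
T-not-anyᵇ⁻ {p = p} (x ∷ xs) none x∈ px with p x in eq | x∈
... | false | here refl  = subst T eq px
... | false | there x∈xs = T-not-anyᵇ⁻ xs none x∈xs px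

T-not-anyᵇ⁺ : ∀ {A : Set} {p : A → Bool} xs → (∀ {x} → x ∈ xs → ¬ T (p x)) → T (not (anyᵇ p xs))
T-not-anyᵇ⁺ []       none = tt
T-not-anyᵇ⁺ {p = p} (x ∷ xs) none with p x in eq
... | true  = none (here refl) (subst T (sym eq) tt)
... | false = T-not-anyᵇ⁺ xs (none ∘ there)

∈-occurrences⁻ : ∀ {R n π i j} → length π ≡ n → (i , j) ∈ occurrences R π → Occ R n π i j
∈-occurrences⁻ {R} {n} {π} {i} {j} refl ij∈
  with ij∈ps , isOcc ← ∈-filter⁻ (isOcc? R π) ij∈
  with i∈ , j∈ ← ∈-cartesianProduct⁻ (positions n) (positions n) ij∈ps
  with i<j , rest ← T-∧⁻ {i <ᵇ j} isOcc
  with rise , clear ← T-∧⁻ {at π i <ᵇ at π j} rest = record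
  { 1≤i   = proj₁ (∈-positions⁻ i∈)
  ; i<j   = <ᵇ⇒< i j i<j
  ; j≤n   = proj₂ (∈-positions⁻ j∈)
  ; rise  = <ᵇ⇒< (at π i) (at π j) rise
  ; clear = λ ab∈R k∈ (x< , <x′) (y< , <y′) →
      T-not-anyᵇ⁻ (positions n) (T-allᵇ⁻ R clear ab∈R) (∈-positions⁺ k∈)
        (T-∧⁺ (<⇒<ᵇ x<) (T-∧⁺ (<⇒<ᵇ <x′) (T-∧⁺ (<⇒<ᵇ y<) (<⇒<ᵇ <y′))))
  }

∈-occurrences⁺ : ∀ {R n π i j} → length π ≡ n → Occ R n π i j → (i , j) ∈ occurrences R π
∈-occurrences⁺ {R} {n} {π} {i} {j} refl o =
  ∈-filter⁺ (isOcc? R π) (∈-cartesianProduct⁺ (∈-positions⁺ i∈) (∈-positions⁺ j∈))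
    (T-∧⁺ (<⇒<ᵇ i<j) (T-∧⁺ (<⇒<ᵇ rise) (T-allᵇ⁺ R λ { {a , b} ab∈R →
      T-not-anyᵇ⁺ (positions n) λ {k} k∈ t →
        let x<   , t₁  = T-∧⁻ {pick a 0 i j (suc n) <ᵇ k} t
            <x′  , t₂  = T-∧⁻ {k <ᵇ pick′ a 0 i j (suc n)} t₁
            y<   , <y′ = T-∧⁻ {pick b 0 (at π i) (at π j) (suc n) <ᵇ at π k} t₂
        in clear ab∈R (∈-positions⁻ k∈)
             (<ᵇ⇒< _ _ x< , <ᵇ⇒< _ _ <x′) (<ᵇ⇒< _ _ y< , <ᵇ⇒< _ _ <y′) })))
  where open Occ o

occ-≤ : ∀ {R S n π ρ} → Perm n π → Perm n ρ → (_~_ : ℕ × ℕ → ℕ × ℕ → Set) →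
  (∀ {i j} → Occ R n π i j → ∃₂ λ i′ j′ → Occ S n ρ i′ j′ × (i , j) ~ (i′ , j′)) →
  (∀ {i j i′ j′ q} → Occ R n π i j → Occ R n π i′ j′ →
     (i , j) ~ q → (i′ , j′) ~ q → (i , j) ≡ (i′ , j′)) →
  occ R π ≤ occ S ρ
occ-≤ {R} {S} {n} {π} {ρ} π↭ ρ↭ _~_ total injective =
  subst₂ _≤_ (sym (occ≡length-occurrences R π)) (sym (occ≡length-occurrences S ρ))
    (injection⇒length≤ _~_ (occurrences-unique R π)
      (λ ij∈ → let i′ , j′ , o , ij~ = total (∈-occurrences⁻ (Perm-length π↭) ij∈)
               in (i′ , j′) , ∈-occurrences⁺ (Perm-length ρ↭) o , ij~)
      (λ p q → injective (∈-occurrences⁻ (Perm-length π↭) p) (∈-occurrences⁻ (Perm-length π↭) q)))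

s-≤ : ∀ {R S n} (_~_ : List ℕ → List ℕ → Set) →
  (∀ {π} → Perm n π → ∃ λ ρ → Perm n ρ × π ~ ρ) →
  (∀ {π π′ ρ} → Perm n π → Perm n π′ → Perm n ρ → π ~ ρ → π′ ~ ρ → π ≡ π′) →
  (∀ {π ρ} → Perm n π → Perm n ρ → π ~ ρ → occ R π ≡ occ S ρ) →
  ∀ k → s n k R ≤ s n k S
s-≤ {R} {S} {n} _~_ total injective occ≡ k =
  subst₂ _≤_ (sym (s≡length-filter n k R)) (sym (s≡length-filter n k S))
    -- `Perm n ρ` is packed into the relation because `injective` asks for it at the common image.
    (injection⇒length≤ (λ π ρ → π ~ ρ × Perm n ρ) (Unique.filter⁺ R? (perms-unique n))
      (λ π∈ →
        let π∈perms , occπ = ∈-filter⁻ R? π∈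
            π↭             = ∈-perms⁻ n π∈perms
            ρ , ρ↭ , π~ρ   = total π↭
        in ρ , ∈-filter⁺ S? (∈-perms⁺ n ρ↭) (subst (λ m → T (m ≡ᵇ k)) (occ≡ π↭ ρ↭ π~ρ) occπ)
             , π~ρ , ρ↭)
      (λ π∈ π′∈ (π~ρ , ρ↭) (π′~ρ , _) →
        injective (∈-perms⁻ n (proj₁ (∈-filter⁻ R? π∈))) (∈-perms⁻ n (proj₁ (∈-filter⁻ R? π′∈)))
          ρ↭ π~ρ π′~ρ))
  where
  R? = λ π → T? (occ R π ≡ᵇ k)
  S? = λ π → T? (occ S π ≡ᵇ k)

-- The symmetries of the square preserving 12

-- Mirror images are described by sums instead of truncated subtraction: if `x′ ≤ y′` held, adding
-- it to `x < y` would give `N < N`.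
reflect-< : ∀ {N x x′ y y′} → x + x′ ≡ N → y + y′ ≡ N → x < y → y′ < x′
reflect-< x+x′ y+y′ x<y =
  ≰⇒> λ x′≤y′ → <-irrefl (trans x+x′ (sym y+y′)) (+-mono-<-≤ x<y x′≤y′)

reflect-<ʳ : ∀ {N x x′ y y′} → x + x′ ≡ N → y + y′ ≡ N → x′ < y′ → y < x
reflect-<ʳ x+x′ y+y′ x′<y′ =
  ≰⇒> λ x≤y → <-irrefl (trans x+x′ (sym y+y′)) (+-mono-≤-< x≤y x′<y′)

reflect-∈ : ∀ {n k k′} → k + k′ ≡ suc n → k ∈[1⋯ n ] → k′ ∈[1⋯ n ]
reflect-∈ {n} {k} k+k′ (1≤k , k≤n) =
  reflect-< k+k′ (+-identityʳ (suc n)) (s≤s k≤n) , s≤s⁻¹ (reflect-< refl k+k′ 1≤k)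

reflection : ∀ {n k} → k ∈[1⋯ n ] → k + (suc n ∸ k) ≡ suc n
reflection (_ , k≤n) = m+[n∸m]≡n (m≤n⇒m≤1+n k≤n)

reflection-∈ : ∀ {n k} → k ∈[1⋯ n ] → (suc n ∸ k) ∈[1⋯ n ]
reflection-∈ k∈ = reflect-∈ (reflection k∈) k∈

module _ {n u u′ v v′} (u+u′ : u + u′ ≡ suc n) (v+v′ : v + v′ ≡ suc n) where

  -- The right border of a column is mirrored to the left border of the opposite column, the outer
  -- borders `0` and `n + 1` included. Mirroring also exchanges the two inner borders, hence the
  -- order `v′ u′`.
  pick-opposite : ∀ a → pick′ a 0 u v (suc n) + pick (opposite a) 0 v′ u′ (suc n) ≡ suc n
  pick-opposite Fin.zero                = u+u′
  pick-opposite (Fin.suc Fin.zero)      = v+v′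
  pick-opposite (Fin.suc (Fin.suc Fin.zero)) = +-identityʳ (suc n)

  pick′-opposite : ∀ a → pick a 0 u v (suc n) + pick′ (opposite a) 0 v′ u′ (suc n) ≡ suc n
  pick′-opposite Fin.zero               = refl
  pick′-opposite (Fin.suc Fin.zero)     = u+u′
  pick′-opposite (Fin.suc (Fin.suc Fin.zero)) = v+v′

  Gap-reflect : ∀ a {k k′} → k + k′ ≡ suc n →
    Gap (opposite a) n v′ u′ k′ → Gap a n u v k
  Gap-reflect a {k} {k′} k+k′ (lo , hi) =
    reflect-<ʳ k+k′ (pick′-opposite a) hi , reflect-<ʳ (pick-opposite a) k+k′ lo

opposite-involutive : (a : Fin 3) → opposite (opposite a) ≡ a
opposite-involutive Fin.zero               = refl
opposite-involutive (Fin.suc Fin.zero)     = refl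
opposite-involutive (Fin.suc (Fin.suc Fin.zero)) = refl

ReverseComplement : ℕ → List ℕ → List ℕ → Set
ReverseComplement n π ρ = ∀ {k k′} → k ∈[1⋯ n ] → k + k′ ≡ suc n → at π k + at ρ k′ ≡ suc n

ReverseComplement-sym : ∀ {n π ρ} → ReverseComplement n π ρ → ReverseComplement n ρ π
ReverseComplement-sym {n} {π} {ρ} rc {k} {k′} k∈ k+k′ =
  trans (+-comm (at ρ k) (at π k′)) (rc (reflect-∈ k+k′ k∈) (trans (+-comm k′ k) k+k′))

reverseComplement : ∀ {n π} → Perm n π → ∃ λ ρ → Perm n ρ × ReverseComplement n π ρ
reverseComplement {n} {π} π↭ = map f (positions n) ,
  Perm-tabulate
    (λ k∈ → reflection-∈ (at-range π↭ (reflection-∈ k∈)))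
    (λ i∈ j∈ eq → reflection-injective i∈ j∈
      (Perm-injective π↭ (reflection-∈ i∈) (reflection-∈ j∈)
        (reflection-injective (at-range π↭ (reflection-∈ i∈)) (at-range π↭ (reflection-∈ j∈)) eq))) ,
  λ {k} {k′} k∈ k+k′ → begin
    at π k + at (map f (positions n)) k′ ≡⟨ cong (at π k +_) (at-map-positions f n (reflect-∈ k+k′ k∈)) ⟩
    at π k + (suc n ∸ at π (suc n ∸ k′)) ≡⟨ cong (λ i → at π k + (suc n ∸ at π i)) (reflect-k k+k′) ⟩
    at π k + (suc n ∸ at π k)            ≡⟨ reflection (at-range π↭ k∈) ⟩
    suc n                                ∎
  where
  open ≡-Reasoning

  f : ℕ → ℕ
  f k = suc n ∸ at π (suc n ∸ k)

  reflect-k : ∀ {k k′} → k + k′ ≡ suc n → suc n ∸ k′ ≡ k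
  reflect-k {k} {k′} k+k′ = trans (cong (_∸ k′) (sym k+k′)) (m+n∸n≡m k k′)

  reflection-injective : ∀ {i j} → i ∈[1⋯ n ] → j ∈[1⋯ n ] → suc n ∸ i ≡ suc n ∸ j → i ≡ j
  reflection-injective (_ , i≤n) (_ , j≤n) = ∸-cancelˡ-≡ (m≤n⇒m≤1+n i≤n) (m≤n⇒m≤1+n j≤n)

ReverseComplement-injective : ∀ {n π π′ ρ} → Perm n π → Perm n π′ →
  ReverseComplement n π ρ → ReverseComplement n π′ ρ → π ≡ π′
ReverseComplement-injective {ρ = ρ} π↭ π′↭ rc rc′ = Perm-ext π↭ π′↭ λ {k} k∈ →
  +-cancelʳ-≡ _ _ _ (trans (rc k∈ (reflection k∈)) (sym (rc′ k∈ (reflection k∈))))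

-- The half-turn exchanges the two points of an occurrence, so the image starts at the mirror of
-- `j`. A point of `ρ` in a box of `S` is turned back to a point of `π` in the opposite box, which
-- `R` shades.
Occ-reverseComplement : ∀ {R S n π ρ i j} → Perm n π → ReverseComplement n π ρ →
  (∀ {a b} → (a , b) ∈ S → (opposite a , opposite b) ∈ R) →
  Occ R n π i j → Occ S n ρ (suc n ∸ j) (suc n ∸ i)
Occ-reverseComplement {n = n} π↭ rc S⊆R o = record
  { 1≤i   = proj₁ (reflection-∈ j∈)
  ; i<j   = reflect-< (reflection i∈) (reflection j∈) i<j
  ; j≤n   = proj₂ (reflection-∈ i∈)
  ; rise  = reflect-< (rc i∈ (reflection i∈)) (rc j∈ (reflection j∈)) rise
  ; clear = λ {a} {b} ab∈S {k} k∈ gap gap′ →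
      let k′+k = trans (+-comm (suc n ∸ k) k) (reflection k∈)
          k′∈  = reflection-∈ k∈
      in clear (S⊆R ab∈S) k′∈
        (Gap-reflect (reflection i∈) (reflection j∈) (opposite a) k′+k
          (subst (λ c → Gap c n _ _ k) (sym (opposite-involutive a)) gap))
        (Gap-reflect (rc i∈ (reflection i∈)) (rc j∈ (reflection j∈)) (opposite b) (rc k′∈ k′+k)
          (subst (λ c → Gap c n _ _ _) (sym (opposite-involutive b)) gap′))
  }
  where open Occ o

occ-reverseComplement-≤ : ∀ {R S n π ρ} → Perm n π → Perm n ρ → ReverseComplement n π ρ →
  (∀ {a b} → (a , b) ∈ S → (opposite a , opposite b) ∈ R) → occ R π ≤ occ S ρ
occ-reverseComplement-≤ {n = n} π↭ ρ↭ rc S⊆R = occ-≤ π↭ ρ↭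
  (λ (i , j) (i′ , j′) → i + j′ ≡ suc n × j + i′ ≡ suc n)
  (λ o → _ , _ , Occ-reverseComplement π↭ rc S⊆R o , reflection (Occ.i∈ o) , reflection (Occ.j∈ o))
  (λ _ _ (p , q) (p′ , q′) →
    cong₂ _,_ (+-cancelʳ-≡ _ _ _ (trans p (sym p′))) (+-cancelʳ-≡ _ _ _ (trans q (sym q′))))

equidistributed-reverseComplement : ∀ {R S} →
  (∀ {a b} → (a , b) ∈ R → (opposite a , opposite b) ∈ S) →
  (∀ {a b} → (a , b) ∈ S → (opposite a , opposite b) ∈ R) → Equidistributed R S
equidistributed-reverseComplement R⊆S S⊆R n k = ≤-antisym (half R⊆S S⊆R) (half S⊆R R⊆S)
  where
  half : ∀ {R S} → (∀ {a b} → (a , b) ∈ R → (opposite a , opposite b) ∈ S) →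
    (∀ {a b} → (a , b) ∈ S → (opposite a , opposite b) ∈ R) → s n k R ≤ s n k S
  half R⊆S S⊆R = s-≤ (ReverseComplement n) reverseComplement
    (λ {_} {_} {ρ} π↭ π′↭ _ rc rc′ → ReverseComplement-injective {ρ = ρ} π↭ π′↭ rc rc′)
    (λ {π} {ρ} π↭ ρ↭ rc → ≤-antisym (occ-reverseComplement-≤ π↭ ρ↭ rc S⊆R)
      (occ-reverseComplement-≤ ρ↭ π↭ (ReverseComplement-sym {π = π} {ρ} rc) R⊆S)) k

-- With both composites recorded, symmetry is a swap of the components.
Inverse : ℕ → List ℕ → List ℕ → Set
Inverse n π ρ = (∀ {k} → k ∈[1⋯ n ] → at ρ (at π k) ≡ k) × (∀ {k} → k ∈[1⋯ n ] → at π (at ρ k) ≡ k)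

inverse : ∀ {n π} → Perm n π → ∃ λ ρ → Perm n ρ × Inverse n π ρ
inverse {n} {π} π↭ = map (index π) (positions n) ,
  Perm-tabulate index-range
    (λ i∈ j∈ eq → trans (sym (at-index (Perm-∈ π↭ i∈))) (trans (cong (at π) eq) (at-index (Perm-∈ π↭ j∈)))) ,
  (λ k∈ → trans (at-map-positions (index π) n (at-range π↭ k∈))
    (Perm-injective π↭ (index-range (at-range π↭ k∈)) k∈ (at-index (Perm-∈ π↭ (at-range π↭ k∈))))) ,
  (λ k∈ → trans (cong (at π) (at-map-positions (index π) n k∈)) (at-index (Perm-∈ π↭ k∈)))
  where
  index-range : ∀ {k} → k ∈[1⋯ n ] → index π k ∈[1⋯ n ]
  index-range k∈ = subst (_ ∈[1⋯_]) (Perm-length π↭) (index-∈ (Perm-∈ π↭ k∈))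

Inverse-injective : ∀ {n π π′ ρ} → Perm n π → Perm n π′ →
  Inverse n π ρ → Inverse n π′ ρ → π ≡ π′
Inverse-injective {π = π} π↭ π′↭ (_ , πρ) (ρπ′ , _) = Perm-ext π↭ π′↭ λ k∈ →
  trans (cong (at π) (sym (ρπ′ k∈))) (πρ (at-range π′↭ k∈))

-- Inversion exchanges the axes of the diagram: values become positions, and column and row of a box
-- trade places.
Occ-inverse : ∀ {R S n π ρ i j} → Perm n π → Perm n ρ → Inverse n π ρ →
  (∀ {a b} → (a , b) ∈ S → (b , a) ∈ R) →
  Occ R n π i j → Occ S n ρ (at π i) (at π j)
Occ-inverse {n = n} {π} {ρ} π↭ ρ↭ (ρπ , πρ) S⊆R o = record
  { 1≤i   = proj₁ (at-range π↭ i∈)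
  ; i<j   = rise
  ; j≤n   = proj₂ (at-range π↭ j∈)
  ; rise  = subst₂ _<_ (sym (ρπ i∈)) (sym (ρπ j∈)) i<j
  ; clear = λ {a} {b} ab∈S {k} k∈ gap gap′ → clear (S⊆R ab∈S) (at-range ρ↭ k∈)
      (subst₂ (λ u v → Gap b n u v (at ρ k)) (ρπ i∈) (ρπ j∈) gap′)
      (subst (Gap a n (at π _) (at π _)) (sym (πρ k∈)) gap)
  }
  where open Occ o

occ-inverse-≤ : ∀ {R S n π ρ} → Perm n π → Perm n ρ → Inverse n π ρ →
  (∀ {a b} → (a , b) ∈ S → (b , a) ∈ R) → occ R π ≤ occ S ρ
occ-inverse-≤ {n = n} {π} π↭ ρ↭ inv S⊆R = occ-≤ π↭ ρ↭
  (λ (i , j) (i′ , j′) → at π i ≡ i′ × at π j ≡ j′)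
  (λ o → _ , _ , Occ-inverse π↭ ρ↭ inv S⊆R o , refl , refl)
  (λ o o′ (p , q) (p′ , q′) → cong₂ _,_
    (Perm-injective π↭ (Occ.i∈ o) (Occ.i∈ o′) (trans p (sym p′)))
    (Perm-injective π↭ (Occ.j∈ o) (Occ.j∈ o′) (trans q (sym q′))))

equidistributed-inverse : ∀ {R S} →
  (∀ {a b} → (a , b) ∈ R → (b , a) ∈ S) →
  (∀ {a b} → (a , b) ∈ S → (b , a) ∈ R) → Equidistributed R S
equidistributed-inverse R⊆S S⊆R n k = ≤-antisym (half R⊆S S⊆R) (half S⊆R R⊆S)
  where
  half : ∀ {R S} → (∀ {a b} → (a , b) ∈ R → (b , a) ∈ S) →
    (∀ {a b} → (a , b) ∈ S → (b , a) ∈ R) → s n k R ≤ s n k S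
  half R⊆S S⊆R = s-≤ (Inverse n) inverse
    (λ {_} {_} {ρ} π↭ π′↭ _ inv inv′ → Inverse-injective {ρ = ρ} π↭ π′↭ inv inv′)
    (λ π↭ ρ↭ inv → ≤-antisym (occ-inverse-≤ π↭ ρ↭ inv S⊆R)
      (occ-inverse-≤ ρ↭ π↭ (Product.swap inv) R⊆S)) k

-- The rank-reversing bijection

AllPairs-remove : ∀ {A : Set} {R : A → A → Set} as {c bs} → AllPairs R (as ++ c ∷ bs) → AllPairs R (as ++ bs)
AllPairs-remove []       (_ ∷ ps)  = ps
AllPairs-remove (a ∷ as) (pa ∷ ps) =
  All.tabulate (λ z∈ → All.lookup pa (∈-insert⁻ as z∈)) ∷ AllPairs-remove as ps
  where
  ∈-insert⁻ : ∀ {z c} as {bs} → z ∈ as ++ bs → z ∈ as ++ c ∷ bs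
  ∈-insert⁻ as z∈ with ∈-++⁻ as z∈
  ... | inj₁ z∈as = ∈-++⁺ˡ z∈as
  ... | inj₂ z∈bs = ∈-++⁺ʳ as (there z∈bs)

AllPairs-before : ∀ {A : Set} {R : A → A → Set} {as c bs a} → AllPairs R (as ++ c ∷ bs) → a ∈ as → R a c
AllPairs-before {as = a ∷ as} (pa ∷ ps) (here refl)  = All.lookup pa (∈-insert as)
AllPairs-before {as = a ∷ as} (pa ∷ ps) (there a∈as) = AllPairs-before ps a∈as

AllPairs-++⁻ʳ : ∀ {A : Set} {R : A → A → Set} as {bs} → AllPairs R (as ++ bs) → AllPairs R bs
AllPairs-++⁻ʳ []       ps       = ps
AllPairs-++⁻ʳ (a ∷ as) (_ ∷ ps) = AllPairs-++⁻ʳ as ps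

AllPairs-after : ∀ {A : Set} {R : A → A → Set} as {c bs b} → AllPairs R (as ++ c ∷ bs) → b ∈ bs → R c b
AllPairs-after as ps b∈bs with pc ∷ _ ← AllPairs-++⁻ʳ as ps = All.lookup pc b∈bs

Sorted : List ℕ → Set
Sorted = AllPairs _<_

-- Reading π from left to right with current left-to-right minimum m, L and U list in
-- increasing order the values still to come below and above m. V does the same for ρ,
-- which has the same left-to-right minima at the same places as π.
data Flip : (L U V π ρ : List ℕ) → Set where
  done : Flip [] [] [] [] []
  low  : ∀ {U V π ρ} L₁ x L₂ →
         Flip L₁ (L₂ ++ U) (L₂ ++ V) π ρ →
         Flip (L₁ ++ x ∷ L₂) U V (x ∷ π) (x ∷ ρ)
  high : ∀ {L π ρ} U₁ x U₂ V₁ y V₂ → length U₁ ≡ length V₂ → length U₂ ≡ length V₁ →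
         Flip L (U₁ ++ U₂) (V₁ ++ V₂) π ρ →
         Flip L (U₁ ++ x ∷ U₂) (V₁ ++ y ∷ V₂) (x ∷ π) (y ∷ ρ)

Flip-sym : ∀ {L U V π ρ} → Flip L U V π ρ → Flip L V U ρ π
Flip-sym done                           = done
Flip-sym (low L₁ x L₂ f)                = low L₁ x L₂ (Flip-sym f)
Flip-sym (high U₁ x U₂ V₁ y V₂ eq eq′ f) = high V₁ y V₂ U₁ x U₂ (sym eq′) (sym eq) (Flip-sym f)

Flip⇒↭ : ∀ {L U V π ρ} → Flip L U V π ρ → π ↭ L ++ U
Flip⇒↭ done = ↭-refl
Flip⇒↭ (low {U} L₁ x L₂ f) = ↭-trans (prep x (Flip⇒↭ f))
  (↭-trans (↭-sym (shift x L₁ (L₂ ++ U))) (↭-reflexive (sym (++-assoc L₁ (x ∷ L₂) U))))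
Flip⇒↭ (high {L} U₁ x U₂ _ _ _ _ _ f) = ↭-trans
  (prep x (↭-trans (Flip⇒↭ f) (↭-reflexive (sym (++-assoc L U₁ U₂)))))
  (↭-trans (↭-sym (shift x (L ++ U₁) U₂)) (↭-reflexive (++-assoc L U₁ (x ∷ U₂))))

length≡0⇒[] : ∀ {A : Set} {xs : List A} → length xs ≡ 0 → xs ≡ []
length≡0⇒[] {xs = []} _ = refl

split-length : ∀ {A : Set} a b (xs : List A) → length xs ≡ a + suc b →
  ∃₂ λ ys z → ∃ λ zs → xs ≡ ys ++ z ∷ zs × length ys ≡ a × length zs ≡ b
split-length zero    b (x ∷ xs) eq = [] , x , xs , refl , refl , suc-injective eq
split-length (suc a) b (x ∷ xs) eq
  with ys , z , zs , refl , eq₁ , eq₂ ← split-length a b xs (suc-injective eq) =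
  x ∷ ys , z , zs , refl , cong suc eq₁ , eq₂

-- Equal lengths of `U` and `V` survive every step: a value from `L` adds the same `L₂` to both, a
-- value from `U` costs each of them one entry.
flip-total : ∀ π {L U V} → π ↭ L ++ U → length U ≡ length V → ∃ λ ρ → Flip L U V π ρ
flip-total [] {L} {U} {V} π↭ |U|≡|V|
  with L++U≡[] ← ↭-empty-inv (↭-sym π↭)
  with refl ← ++-conicalˡ L U L++U≡[]
  with refl ← ++-conicalʳ L U L++U≡[]
  with refl ← length≡0⇒[] {xs = V} (sym |U|≡|V|) = [] , done
flip-total (x ∷ π) {L} {U} {V} π↭ |U|≡|V| with ∈-++⁻ L (∈-resp-↭ π↭ (here refl))
... | inj₁ x∈L
  with L₁ , L₂ , refl ← ∈-∃++ x∈L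
  with ρ , f ← flip-total π {V = L₂ ++ V}
         (drop-mid [] L₁ (↭-trans π↭ (↭-reflexive (++-assoc L₁ (x ∷ L₂) U))))
         (trans (length-++ L₂) (trans (cong (length L₂ +_) |U|≡|V|) (sym (length-++ L₂)))) =
  x ∷ ρ , low L₁ x L₂ f
... | inj₂ x∈U
  with U₁ , U₂ , refl ← ∈-∃++ x∈U
  -- `x` has `length U₁` available values below it and `length U₂` above it; cutting `V` after
  -- `length U₂` entries gives `y` the opposite rank.
  with V₁ , y , V₂ , refl , |V₁| , |V₂| ← split-length (length U₂) (length U₁) V
         (trans (sym |U|≡|V|) (trans (length-++-sucʳ U₁ x U₂)
           (trans (cong suc (trans (length-++ U₁) (+-comm (length U₁) _))) (sym (+-suc _ _)))))
  with ρ , f ← flip-total π {V = V₁ ++ V₂}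
         (↭-trans (drop-mid [] (L ++ U₁) (↭-trans π↭ (↭-reflexive (sym (++-assoc L U₁ (x ∷ U₂))))))
           (↭-reflexive (++-assoc L U₁ U₂)))
         (trans (length-++ U₁) (trans (+-comm (length U₁) _)
           (trans (cong₂ _+_ (sym |V₁|) (sym |V₂|)) (sym (length-++ V₁))))) =
  y ∷ ρ , high U₁ x U₂ V₁ y V₂ (sym |V₂|) (sym |V₁|) f

++-injective : ∀ {A : Set} as {bs : List A} cs {ds} → length as ≡ length cs →
  as ++ bs ≡ cs ++ ds → as ≡ cs × bs ≡ ds
++-injective []       []       _  eq = refl , eq
++-injective (a ∷ as) (c ∷ cs) |≡| eq
  with refl , eq′ ← ∷-injective eq
  with refl , refl ← ++-injective as cs (suc-injective |≡|) eq′ = refl , refl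

-- The indices come with equations because unification cannot invert `L₁ ++ x ∷ L₂`. Uniqueness of
-- `L ++ U` decides between `low` and `high` and fixes the cut around `x`; the lengths then fix the
-- cut of `V`.
flip-functional : ∀ {L U V π ρ L′ U′ V′ π′ ρ′} → Unique (L ++ U) →
  Flip L U V π ρ → Flip L′ U′ V′ π′ ρ′ →
  L ≡ L′ → U ≡ U′ → V ≡ V′ → π ≡ π′ → ρ ≡ ρ′
flip-functional _ done done _ _ _ _ = refl
flip-functional LU! (low {U} L₁ x L₂ f) (low L₁′ _ L₂′ f′) L≡ refl refl refl
  with LU!′ ← subst Unique (++-assoc L₁ (x ∷ L₂) U) LU!
  with refl , refl ← split-unique L₁ L₁′
         (λ x∈ → AllPairs-before LU!′ x∈ refl)
         (λ x∈ → AllPairs-before (subst Unique (trans (cong (_++ U) L≡) (++-assoc L₁′ (x ∷ L₂′) U)) LU!) x∈ refl)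
         L≡ =
  cong (x ∷_) (flip-functional (AllPairs-remove L₁ LU!′) f f′ refl refl refl refl)
flip-functional LU! (high {L} U₁ x U₂ V₁ y V₂ eq₁ eq₂ f) (high U₁′ _ U₂′ V₁′ y′ V₂′ eq₁′ eq₂′ f′) refl U≡ V≡ refl
  with LU!′ ← subst Unique (sym (++-assoc L U₁ (x ∷ U₂))) LU!
  with refl , refl ← split-unique U₁ U₁′
         (λ x∈ → AllPairs-before LU!′ (∈-++⁺ʳ L x∈) refl)
         (λ x∈ → AllPairs-before
           (subst Unique (trans (cong (L ++_) U≡) (sym (++-assoc L U₁′ (x ∷ U₂′)))) LU!) (∈-++⁺ʳ L x∈) refl)
         U≡
  with refl , yV≡ ← ++-injective V₁ V₁′ (trans (sym eq₂) eq₂′) V≡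
  with refl , refl ← ∷-injective yV≡ =
  cong (y ∷_) (flip-functional
    (subst Unique (++-assoc L U₁ U₂) (AllPairs-remove (L ++ U₁) LU!′)) f f′ refl refl refl refl)
flip-functional LU! (low L₁ x L₂ f) (high U₁ _ U₂ _ _ _ _ _ _) _ refl _ refl =
  ⊥-elim (AllPairs-before (subst Unique (sym (++-assoc (L₁ ++ x ∷ L₂) U₁ (x ∷ U₂))) LU!)
    (∈-++⁺ˡ {ys = U₁} (∈-insert L₁)) refl)
flip-functional LU! (high {L} U₁ x U₂ _ _ _ _ _ _) (low L₁ _ L₂ _) refl _ _ refl =
  ⊥-elim (AllPairs-before (subst Unique (sym (++-assoc (L₁ ++ x ∷ L₂) U₁ (x ∷ U₂))) LU!)
    (∈-++⁺ˡ {ys = U₁} (∈-insert L₁)) refl)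

-- Least and greatest available entries: `q` has been read, `s` is still to come.

record LeastAbove (q : List ℕ) (x : ℕ) (s : List ℕ) : Set where
  constructor leastAbove
  field
    above : ∃ λ i → i ∈ q × i < x
    least : ∀ {i k} → i ∈ q → k ∈ s → i < k → k < x → ⊥

record GreatestAbove (q : List ℕ) (x : ℕ) (s : List ℕ) : Set where
  constructor greatestAbove
  field
    above    : ∃ λ i → i ∈ q × i < x
    greatest : ∀ {k} → k ∈ s → x < k → ⊥

-- A comparison of minima without computing them: if `q` has an entry below `x`, the minimum of `q′`
-- is at most that of `q`. Entries from `x` upwards do not affect the two conditions above, so they
-- may be dropped freely.
Refines : ℕ → List ℕ → List ℕ → Set
Refines x q q′ = ∀ {i} → i ∈ q → i < x → ∃ λ i′ → i′ ∈ q′ × i′ ≤ i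

Refines-above : ∀ {x q q′} → Refines x q q′ → (∃ λ i → i ∈ q × i < x) → ∃ λ i → i ∈ q′ × i < x
Refines-above q⊑q′ (i , i∈q , i<x) with i′ , i′∈q′ , i′≤i ← q⊑q′ i∈q i<x =
  i′ , i′∈q′ , ≤-<-trans i′≤i i<x

LeastAbove-resp : ∀ {x s q q′} → Refines x q q′ → Refines x q′ q → LeastAbove q x s → LeastAbove q′ x s
LeastAbove-resp q⊑q′ q′⊑q (leastAbove above least) = leastAbove (Refines-above q⊑q′ above)
  λ i∈q′ k∈s i<k k<x → let i′ , i′∈q , i′≤i = q′⊑q i∈q′ (<-trans i<k k<x)
                       in least i′∈q k∈s (≤-<-trans i′≤i i<k) k<x

GreatestAbove-resp : ∀ {x s q q′} → Refines x q q′ → GreatestAbove q x s → GreatestAbove q′ x s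
GreatestAbove-resp q⊑q′ (greatestAbove above greatest) = greatestAbove (Refines-above q⊑q′ above) greatest

Refines-⊆ : ∀ {x q q′} → (∀ {i} → i ∈ q → i ∈ q′) → Refines x q q′
Refines-⊆ q⊆q′ i∈q _ = _ , q⊆q′ i∈q , ≤-refl

Refines-head : ∀ {x m a q q′} → a ≤ m → a ∈ q′ → Refines x q q′ → Refines x (m ∷ q) q′
Refines-head a≤m a∈q′ q⊑q′ (here refl) _   = _ , a∈q′ , a≤m
Refines-head a≤m a∈q′ q⊑q′ (there i∈q) i<x = q⊑q′ i∈q i<x

-- For a `low` step: the new minimum `x` makes `m` obsolete. The next two lemmas serve a `high`
-- step, after which `m` is still the minimum.
Refines-drop-first : ∀ {z m x p} → x < m → Refines z (m ∷ x ∷ p) (x ∷ p)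
Refines-drop-first x<m = Refines-head (<⇒≤ x<m) (here refl) (Refines-⊆ id)

Refines-drop-second : ∀ {z m x p} → m < x → Refines z (m ∷ x ∷ p) (m ∷ p)
Refines-drop-second m<x = Refines-head ≤-refl (here refl)
  (Refines-head (<⇒≤ m<x) (here refl) (Refines-⊆ there))

Refines-keep-second : ∀ {z m x p} → Refines z (m ∷ p) (m ∷ x ∷ p)
Refines-keep-second = Refines-⊆ λ { (here refl) → here refl ; (there i∈p) → there (there i∈p) }

module _ {L m U₁ x U₂ s} (sorted : Sorted (L ++ m ∷ U₁ ++ x ∷ U₂)) (s↭ : s ↭ L ++ U₁ ++ U₂) where

  private
    ∈L⇒<m : ∀ {k} → k ∈ L → k < m
    ∈L⇒<m = AllPairs-before sorted

    m<x : m < x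
    m<x = AllPairs-after L sorted (∈-insert U₁)

    sortedU : Sorted (U₁ ++ x ∷ U₂)
    sortedU = AllPairs-++⁻ʳ (m ∷ []) (AllPairs-++⁻ʳ L sorted)

  -- The first entry of `U₁` would be a remaining value strictly between `m` and `x`.
  least⇒U₁≡[] : LeastAbove (m ∷ []) x s → U₁ ≡ []
  least⇒U₁≡[] (leastAbove _ least) = go refl
    where
    go : ∀ {W} → U₁ ≡ W → U₁ ≡ []
    go {[]}    eq   = eq
    go {u ∷ W} refl = ⊥-elim (least (here refl)
      (∈-resp-↭ (↭-sym s↭) (∈-++⁺ʳ L (here refl)))
      (AllPairs-after L sorted (here refl)) (AllPairs-before sortedU (here refl)))

  U₁≡[]⇒least : U₁ ≡ [] → LeastAbove (m ∷ []) x s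
  U₁≡[]⇒least refl = leastAbove (m , here refl , m<x) λ where
    (here refl) k∈s m<k k<x → case ∈-++⁻ L (∈-resp-↭ s↭ k∈s) of λ where
      (inj₁ k∈L)  → <-asym m<k (∈L⇒<m k∈L)
      (inj₂ k∈U₂) → <-asym k<x (AllPairs-after [] sortedU k∈U₂)

  greatest⇒U₂≡[] : GreatestAbove (m ∷ []) x s → U₂ ≡ []
  greatest⇒U₂≡[] (greatestAbove _ greatest) = go refl
    where
    go : ∀ {W} → U₂ ≡ W → U₂ ≡ []
    go {[]}    eq   = eq
    go {u ∷ W} refl = ⊥-elim (greatest
      (∈-resp-↭ (↭-sym s↭) (∈-++⁺ʳ L (∈-++⁺ʳ U₁ (here refl))))
      (AllPairs-after U₁ sortedU (here refl)))

  U₂≡[]⇒greatest : U₂ ≡ [] → GreatestAbove (m ∷ []) x s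
  U₂≡[]⇒greatest refl = greatestAbove (m , here refl , m<x) λ k∈s x<k →
    case ∈-++⁻ L (∈-resp-↭ s↭ k∈s) of λ where
      (inj₁ k∈L) → <-asym x<k (<-trans (∈L⇒<m k∈L) m<x)
      (inj₂ k∈U) → case ∈-++⁻ U₁ k∈U of λ where
        (inj₁ k∈U₁) → <-asym x<k (AllPairs-before sortedU k∈U₁)

-- The old minimum `m` leaves the list, and `x` becomes the divider between lower and upper values.
sorted-low : ∀ L₁ {x L₂ m U} → Sorted ((L₁ ++ x ∷ L₂) ++ m ∷ U) → Sorted (L₁ ++ x ∷ L₂ ++ U)
sorted-low L₁ {x} {L₂} {m} {U} sorted =
  subst Sorted (++-assoc L₁ (x ∷ L₂) U) (AllPairs-remove (L₁ ++ x ∷ L₂) sorted)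

sorted-high : ∀ L {m} U₁ {x U₂} → Sorted (L ++ m ∷ U₁ ++ x ∷ U₂) → Sorted (L ++ m ∷ U₁ ++ U₂)
sorted-high L {m} U₁ {x} {U₂} sorted = subst Sorted (++-assoc L (m ∷ U₁) U₂)
  (AllPairs-remove (L ++ m ∷ U₁) (subst Sorted (sym (++-assoc L (m ∷ U₁) (x ∷ U₂))) sorted))

-- `m` stands for everything read so far, and `p`, `p′` lead to the entries compared. Once these are
-- reached, `length U₁ ≡ length V₂` turns the absence of a smaller available value in `π` into the
-- absence of a larger one in `ρ`.
flip-least⇒greatest : ∀ {L m U V π ρ} → Sorted (L ++ m ∷ U) → Sorted (L ++ m ∷ V) →
  Flip L U V π ρ → ∀ p p′ {x y s s′} →
  π ≡ p ++ x ∷ s → ρ ≡ p′ ++ y ∷ s′ → length p ≡ length p′ →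
  LeastAbove (m ∷ p) x s → GreatestAbove (m ∷ p′) y s′
-- A new left-to-right minimum has no smaller entry before it.
flip-least⇒greatest LU LV (low L₁ x L₂ f) [] [] refl refl _ (leastAbove (_ , here refl , m<x) _) =
  ⊥-elim (<-asym m<x (AllPairs-before LU (∈-insert L₁)))
flip-least⇒greatest LU LV (low L₁ x L₂ f) (_ ∷ p) (_ ∷ p′) refl refl |≡| la =
  GreatestAbove-resp (Refines-⊆ there)
    (flip-least⇒greatest (sorted-low L₁ LU) (sorted-low L₁ LV) f p p′ refl refl (suc-injective |≡|)
      (LeastAbove-resp (Refines-drop-first x<m) (Refines-⊆ there) la))
  where x<m = AllPairs-before LU (∈-insert L₁)
flip-least⇒greatest {L} LU LV (high U₁ x U₂ V₁ y V₂ eq _ f) [] [] refl refl _ la =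
  U₂≡[]⇒greatest LV (Flip⇒↭ (Flip-sym f))
    (length≡0⇒[] (trans (sym eq) (cong length (least⇒U₁≡[] LU (Flip⇒↭ f) la))))
flip-least⇒greatest {L} LU LV (high U₁ x U₂ V₁ y V₂ _ _ f) (_ ∷ p) (_ ∷ p′) refl refl |≡| la =
  GreatestAbove-resp Refines-keep-second
    (flip-least⇒greatest (sorted-high L U₁ LU) (sorted-high L V₁ LV) f p p′ refl refl (suc-injective |≡|)
      (LeastAbove-resp (Refines-drop-second (AllPairs-after L LU (∈-insert U₁))) Refines-keep-second la))

flip-greatest⇒least : ∀ {L m U V π ρ} → Sorted (L ++ m ∷ U) → Sorted (L ++ m ∷ V) →
  Flip L U V π ρ → ∀ p p′ {x y s s′} →
  π ≡ p ++ x ∷ s → ρ ≡ p′ ++ y ∷ s′ → length p ≡ length p′ →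
  GreatestAbove (m ∷ p′) y s′ → LeastAbove (m ∷ p) x s
flip-greatest⇒least LU LV (low L₁ x L₂ f) [] [] refl refl _ (greatestAbove (_ , here refl , m<x) _) =
  ⊥-elim (<-asym m<x (AllPairs-before LU (∈-insert L₁)))
flip-greatest⇒least LU LV (low L₁ x L₂ f) (_ ∷ p) (_ ∷ p′) refl refl |≡| ga =
  LeastAbove-resp (Refines-⊆ there) (Refines-drop-first x<m)
    (flip-greatest⇒least (sorted-low L₁ LU) (sorted-low L₁ LV) f p p′ refl refl (suc-injective |≡|)
      (GreatestAbove-resp (Refines-drop-first x<m) ga))
  where x<m = AllPairs-before LU (∈-insert L₁)
flip-greatest⇒least {L} LU LV (high U₁ x U₂ V₁ y V₂ eq _ f) [] [] refl refl _ ga =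
  U₁≡[]⇒least LU (Flip⇒↭ f)
    (length≡0⇒[] (trans eq (cong length (greatest⇒U₂≡[] LV (Flip⇒↭ (Flip-sym f)) ga))))
flip-greatest⇒least {L} LU LV (high U₁ x U₂ V₁ y V₂ _ _ f) (_ ∷ p) (_ ∷ p′) refl refl |≡| ga =
  LeastAbove-resp Refines-keep-second (Refines-drop-second (AllPairs-after L LU (∈-insert U₁)))
    (flip-greatest⇒least (sorted-high L U₁ LU) (sorted-high L V₁ LV) f p p′ refl refl (suc-injective |≡|)
      (GreatestAbove-resp (Refines-drop-second (AllPairs-after L LV (∈-insert V₁))) ga))

-- Cutting a list at a position: from indices to prefixes and suffixes.

record Split (π : List ℕ) (j : ℕ) : Set where
  field
    before after  : List ℕ
    split         : π ≡ before ++ at π j ∷ after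
    length-before : suc (length before) ≡ j
    at-before     : ∀ {i} → 1 ≤ i → i < j → at π i ∈ before
    before-at     : ∀ {v} → v ∈ before → ∃ λ i → 1 ≤ i × i < j × at π i ≡ v
    at-after      : ∀ {k} → j < k → k ≤ length π → at π k ∈ after
    after-at      : ∀ {v} → v ∈ after → ∃ λ k → j < k × k ≤ length π × at π k ≡ v

splitAt : ∀ π {j} → j ∈[1⋯ length π ] → Split π j
splitAt []      {suc _} (_ , ())
splitAt (_ ∷ _) {zero}  (() , _)
splitAt (x ∷ π) {suc zero} _ = record
  { before        = []
  ; after         = π
  ; split         = refl
  ; length-before = refl
  ; at-before     = λ { 1≤i (s≤s i≤0) → ⊥-elim (1+n≰n (≤-trans 1≤i i≤0)) }
  ; before-at     = λ ()
  ; at-after      = λ { {suc (suc k)} _ k≤n → at-∈ π (s≤s z≤n , s≤s⁻¹ k≤n) ; {suc zero} (s≤s ()) _ }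
  ; after-at      = λ {v} v∈ → suc (index π v) , s≤s (proj₁ (index-∈ v∈)) , s≤s (proj₂ (index-∈ v∈)) ,
                               at-suc (proj₁ (index-∈ v∈)) (at-index v∈)
  }
  where
  at-suc : ∀ {k v} → 1 ≤ k → at π k ≡ v → at (x ∷ π) (suc k) ≡ v
  at-suc {suc k} _ eq = eq
splitAt (x ∷ π) {suc (suc j)} (_ , j≤n) = record
  { before        = x ∷ before
  ; after         = after
  ; split         = cong (x ∷_) split
  ; length-before = cong suc length-before
  ; at-before     = λ { {suc zero} _ _ → here refl
                      ; {suc (suc i)} _ i<j → there (at-before (s≤s z≤n) (s≤s⁻¹ i<j)) }
  ; before-at     = λ { (here refl) → 1 , s≤s z≤n , s≤s (s≤s z≤n) , refl
                      ; (there v∈)  → case before-at v∈ of λ where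
                          (suc i , 1≤i , i<j , eq) → suc (suc i) , s≤s z≤n , s≤s i<j , eq }
  ; at-after      = λ { {suc (suc k)} j<k k≤n → at-after (s≤s⁻¹ j<k) (s≤s⁻¹ k≤n)
                      ; {suc zero} (s≤s ()) _ }
  ; after-at      = λ v∈ → case after-at v∈ of λ where
                      (suc k , j<k , k≤n , eq) → suc (suc k) , s≤s j<k , s≤s k≤n , eq
  }
  where open Split (splitAt π {suc j} (s≤s z≤n , s≤s⁻¹ j≤n))

-- Indices are places in the list twelve.
R₄ R₅ R₁₂ : List Box
R₄  = (b2 , b1) ∷ (b1 , b0) ∷ (b0 , b0) ∷ []
R₅  = (b2 , b2) ∷ (b0 , b1) ∷ (b1 , b1) ∷ []
R₁₂ = (b2 , b2) ∷ (b0 , b0) ∷ (b1 , b0) ∷ []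

-- Occurrences described by their upper points.

module _ {n π} (π↭ : Perm n π) where

  private
    prefix-∈ : ∀ {k j} → j ≤ n → 1 ≤ k → k < j → k ∈[1⋯ n ]
    prefix-∈ j≤n 1≤k k<j = 1≤k , ≤-trans (<⇒≤ k<j) j≤n

  -- The two boxes cover everything to the left of `j` and below the lower point, except the
  -- vertical line through that point.
  Occ-prefix-min : ∀ {R i j} → (b0 , b0) ∈ R → (b1 , b0) ∈ R → Occ R n π i j →
    ∀ {k} → 1 ≤ k → k < j → at π i ≤ at π k
  Occ-prefix-min {i = i} {j} 00∈R 10∈R o {k} 1≤k k<j = ≮⇒≥ λ πk<πi →
    let k∈     = prefix-∈ j≤n 1≤k k<j
        bottom = proj₁ (at-range π↭ k∈) , πk<πi
    in case <-cmp k i of λ where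
      (tri< k<i _ _)    → clear 00∈R k∈ (1≤k , k<i) bottom
      (tri≈ _ refl _)   → <-irrefl refl πk<πi
      (tri> _ _ i<k)    → clear 10∈R k∈ (i<k , k<j) bottom
    where open Occ o

  -- To the left of `j` the two boxes cover the horizontal strip between the two points, again up to
  -- the line through the lower one.
  Occ-prefix-max-below : ∀ {R i j} → (b0 , b1) ∈ R → (b1 , b1) ∈ R → Occ R n π i j →
    ∀ {k} → 1 ≤ k → k < j → at π k < at π j → at π k ≤ at π i
  Occ-prefix-max-below {i = i} {j} 01∈R 11∈R o {k} 1≤k k<j πk<πj = ≮⇒≥ λ πi<πk →
    let k∈ = prefix-∈ j≤n 1≤k k<j
    in case <-cmp k i of λ where
      (tri< k<i _ _)    → clear 01∈R k∈ (1≤k , k<i) (πi<πk , πk<πj)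
      (tri≈ _ refl _)   → <-irrefl refl πi<πk
      (tri> _ _ i<k)    → clear 11∈R k∈ (i<k , k<j) (πi<πk , πk<πj)
    where open Occ o

  Occ-unique-min : ∀ {R i i′ j} → (b0 , b0) ∈ R → (b1 , b0) ∈ R →
    Occ R n π i j → Occ R n π i′ j → i ≡ i′
  Occ-unique-min 00∈R 10∈R o o′ = Perm-injective π↭ (Occ.i∈ o) (Occ.i∈ o′) (≤-antisym
    (Occ-prefix-min 00∈R 10∈R o (Occ.1≤i o′) (Occ.i<j o′))
    (Occ-prefix-min 00∈R 10∈R o′ (Occ.1≤i o) (Occ.i<j o)))

  Occ-unique-max-below : ∀ {R i i′ j} → (b0 , b1) ∈ R → (b1 , b1) ∈ R →
    Occ R n π i j → Occ R n π i′ j → i ≡ i′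
  Occ-unique-max-below 01∈R 11∈R o o′ = Perm-injective π↭ (Occ.i∈ o) (Occ.i∈ o′) (≤-antisym
    (Occ-prefix-max-below 01∈R 11∈R o′ (Occ.1≤i o) (Occ.i<j o) (Occ.rise o))
    (Occ-prefix-max-below 01∈R 11∈R o (Occ.1≤i o′) (Occ.i<j o′) (Occ.rise o′)))

  splitPerm : ∀ {j} → j ∈[1⋯ n ] → Split π j
  splitPerm j∈ = splitAt π (subst (_ ∈[1⋯_]) (sym (Perm-length π↭)) j∈)

  module _ {j} (j∈ : j ∈[1⋯ n ]) where
    open Split (splitPerm j∈)

    private
      ≤n⇒≤length : ∀ {k} → k ≤ n → k ≤ length π
      ≤n⇒≤length {k} = subst (k ≤_) (sym (Perm-length π↭))

      ≤length⇒≤n : ∀ {k} → k ≤ length π → k ≤ n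
      ≤length⇒≤n {k} = subst (k ≤_) (Perm-length π↭)

      after-∈ : ∀ {k} → j < k → k ≤ length π → k ∈[1⋯ n ]
      after-∈ j<k k≤n = ≤-trans (proj₁ j∈) (<⇒≤ j<k) , ≤length⇒≤n k≤n

      lower-left : (∃ λ v → v ∈ before × v < at π j) → ∃ λ i → 1 ≤ i × i < j × at π i < at π j
      lower-left (_ , v∈ , v<) with i , 1≤i , i<j , refl ← before-at v∈ = i , 1≤i , i<j , v<

      clear-top : GreatestAbove before (at π j) after →
        ∀ {k} → k ∈[1⋯ n ] → j < k × k < suc n → at π j < at π k × at π k < suc n → ⊥
      clear-top ga (_ , k≤n) (j<k , _) (πj<πk , _) =
        GreatestAbove.greatest ga (at-after j<k (≤n⇒≤length k≤n)) πj<πk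

    prefix-argmin : ∀ {i} → 1 ≤ i → i < j → ∃ λ i₀ → 1 ≤ i₀ × i₀ < j × at π i₀ ≤ at π i ×
      (∀ {k} → 1 ≤ k → k < j → at π i₀ ≤ at π k)
    -- Since `j` is `suc j′`, `positions j′` lists the positions before `j`. The default value `i`
    -- is one of them.
    prefix-argmin {i} 1≤i i<j@(s≤s {n = j′} _) =
      let 1≤i₀ , i₀<j = Extrema.argmin-all (at π) {P = λ k → 1 ≤ k × k < j} (1≤i , i<j)
                          (All.tabulate (Product.map₂ s≤s ∘ ∈-positions⁻))
      in Extrema.argmin (at π) i (positions j′) , 1≤i₀ , i₀<j ,
         Extrema.f[argmin]≤f[⊤] {f = at π} i (positions j′) ,
         λ 1≤k k<j → All.lookup (Extrema.f[argmin]≤f[xs] {f = at π} i (positions j′))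
                       (∈-positions⁺ (1≤k , s≤s⁻¹ k<j))

    prefix-argmax-below : ∀ {i} → 1 ≤ i → i < j → at π i < at π j →
      ∃ λ i₀ → 1 ≤ i₀ × i₀ < j × at π i₀ < at π j ×
      (∀ {k} → 1 ≤ k → k < j → at π k < at π j → at π k ≤ at π i₀)
    prefix-argmax-below {i} 1≤i i<j@(s≤s {n = j′} _) πi<πj =
      let 1≤i₀ , i₀<j , πi₀<πj =
            Extrema.argmax-all (at π) {P = λ k → 1 ≤ k × k < j × at π k < at π j} (1≤i , i<j , πi<πj)
              (All.tabulate λ k∈ → let k∈ps , πk<πj = ∈-filter⁻ below? k∈
                                       1≤k , k≤j′   = ∈-positions⁻ k∈ps
                                   in 1≤k , s≤s k≤j′ , πk<πj)
      in Extrema.argmax (at π) i (filter below? (positions j′)) , 1≤i₀ , i₀<j , πi₀<πj ,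
         λ 1≤k k<j πk<πj → All.lookup (Extrema.f[xs]≤f[argmax] {f = at π} i (filter below? (positions j′)))
                             (∈-filter⁺ below? (∈-positions⁺ (1≤k , s≤s⁻¹ k<j)) πk<πj)
      where
      below? : ∀ k → Dec (at π k < at π j)
      below? k = at π k <? at π j

    Occ-above : ∀ {R i} → Occ R n π i j → ∃ λ v → v ∈ before × v < at π j
    Occ-above o = _ , at-before 1≤i i<j , rise
      where open Occ o

    Occ₄⇒least : ∀ {i} → Occ R₄ n π i j → LeastAbove before (at π j) after
    Occ₄⇒least {i} o = leastAbove (Occ-above o) λ u∈ v∈ u<v v<πj →
      case before-at u∈ of λ where
        (a , 1≤a , a<j , refl) → case after-at v∈ of λ where
          -- The lower point is at most `u`, so `v` would lie in the shaded box `(b2 , b1)`.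
          (c , j<c , c≤n , refl) → Occ.clear o (here refl) (after-∈ j<c c≤n)
            (j<c , s≤s (≤length⇒≤n c≤n))
            (≤-<-trans (Occ-prefix-min (there (there (here refl))) (there (here refl)) o 1≤a a<j) u<v , v<πj)

    -- The prefix minimum is the only candidate for the lower point; `least`, applied to it, empties
    -- the box `(b2 , b1)`.
    least⇒Occ₄ : LeastAbove before (at π j) after → ∃ λ i → Occ R₄ n π i j
    least⇒Occ₄ (leastAbove above least) =
      let i , 1≤i , i<j , πi<πj = lower-left above
          i₀ , 1≤i₀ , i₀<j , πi₀≤πi , min = prefix-argmin 1≤i i<j
      in i₀ , record
      { 1≤i   = 1≤i₀
      ; i<j   = i₀<j
      ; j≤n   = proj₂ j∈
      ; rise  = ≤-<-trans πi₀≤πi πi<πj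
      ; clear = λ where
          (here refl) (_ , k≤n) (j<k , _) (πi₀<πk , πk<πj) →
            least (at-before 1≤i₀ i₀<j) (at-after j<k (≤n⇒≤length k≤n)) πi₀<πk πk<πj
          (there (here refl)) (1≤k , _) (_ , k<j) (_ , πk<πi₀) → ≤⇒≯ (min 1≤k k<j) πk<πi₀
          (there (there (here refl))) (1≤k , _) (_ , k<i₀) (_ , πk<πi₀) →
            ≤⇒≯ (min 1≤k (<-trans k<i₀ i₀<j)) πk<πi₀
      }

    Occ⇒greatest : ∀ {R i} → (b2 , b2) ∈ R → Occ R n π i j → GreatestAbove before (at π j) after
    Occ⇒greatest 22∈R o = greatestAbove (Occ-above o) λ v∈ πj<v → case after-at v∈ of λ where
      (k , j<k , k≤n , refl) → let k∈ = after-∈ j<k k≤n in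
        Occ.clear o 22∈R k∈ (j<k , s≤s (proj₂ k∈)) (πj<v , s≤s (proj₂ (at-range π↭ k∈)))

    greatest⇒Occ₁₂ : GreatestAbove before (at π j) after → ∃ λ i → Occ R₁₂ n π i j
    greatest⇒Occ₁₂ ga =
      let i , 1≤i , i<j , πi<πj = lower-left (GreatestAbove.above ga)
          i₀ , 1≤i₀ , i₀<j , πi₀≤πi , min = prefix-argmin 1≤i i<j
      in i₀ , record
      { 1≤i   = 1≤i₀
      ; i<j   = i₀<j
      ; j≤n   = proj₂ j∈
      ; rise  = ≤-<-trans πi₀≤πi πi<πj
      ; clear = λ where
          (here refl) → clear-top ga
          (there (here refl)) (1≤k , _) (_ , k<i₀) (_ , πk<πi₀) →
            ≤⇒≯ (min 1≤k (<-trans k<i₀ i₀<j)) πk<πi₀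
          (there (there (here refl))) (1≤k , _) (_ , k<j) (_ , πk<πi₀) → ≤⇒≯ (min 1≤k k<j) πk<πi₀
      }

    -- The upper points are those of `R₁₂`; only the lower point changes, to the greatest earlier
    -- entry below `at π j`.
    greatest⇒Occ₅ : GreatestAbove before (at π j) after → ∃ λ i → Occ R₅ n π i j
    greatest⇒Occ₅ ga =
      let i , 1≤i , i<j , πi<πj = lower-left (GreatestAbove.above ga)
          i₀ , 1≤i₀ , i₀<j , πi₀<πj , max = prefix-argmax-below 1≤i i<j πi<πj
      in i₀ , record
      { 1≤i   = 1≤i₀
      ; i<j   = i₀<j
      ; j≤n   = proj₂ j∈
      ; rise  = πi₀<πj
      ; clear = λ where
          (here refl) → clear-top ga
          (there (here refl)) (1≤k , _) (_ , k<i₀) (πi₀<πk , πk<πj) →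
            ≤⇒≯ (max 1≤k (<-trans k<i₀ i₀<j) πk<πj) πi₀<πk
          (there (there (here refl))) (1≤k , _) (_ , k<j) (πi₀<πk , πk<πj) →
            ≤⇒≯ (max 1≤k k<j πk<πj) πi₀<πk
      }

-- Sharing the upper point is an injective relation as soon as the upper point determines the lower
-- one.
occ-≤-same-top : ∀ {R S n π ρ} → Perm n π → Perm n ρ →
  (∀ {i j} → Occ R n π i j → ∃ λ i′ → Occ S n ρ i′ j) →
  (∀ {i i′ j} → Occ R n π i j → Occ R n π i′ j → i ≡ i′) → occ R π ≤ occ S ρ
occ-≤-same-top π↭ ρ↭ total unique = occ-≤ π↭ ρ↭ (λ (_ , j) (_ , j′) → j ≡ j′)
  (λ {_} {j} o → let i′ , o′ = total o in i′ , j , o′ , refl)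
  (λ { o o′ refl refl → cong (_, _) (unique o o′) })

occ₅≡occ₁₂ : ∀ {n π} → Perm n π → occ R₅ π ≡ occ R₁₂ π
occ₅≡occ₁₂ π↭ = ≤-antisym
  (occ-≤-same-top π↭ π↭
    (λ o → greatest⇒Occ₁₂ π↭ (Occ.j∈ o) (Occ⇒greatest π↭ (Occ.j∈ o) (here refl) o))
    (Occ-unique-max-below π↭ (there (here refl)) (there (there (here refl)))))
  (occ-≤-same-top π↭ π↭
    (λ o → greatest⇒Occ₅ π↭ (Occ.j∈ o) (Occ⇒greatest π↭ (Occ.j∈ o) (here refl) o))
    (Occ-unique-min π↭ (there (here refl)) (there (there (here refl)))))

equidistributed-occ≡ : ∀ {R S} → (∀ {n π} → Perm n π → occ R π ≡ occ S π) → Equidistributed R S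
equidistributed-occ≡ occ≡ n k = ≤-antisym (half occ≡) (half (sym ∘ occ≡))
  where
  half : ∀ {R S} → (∀ {π} → Perm n π → occ R π ≡ occ S π) → s n k R ≤ s n k S
  half occ≡ = s-≤ _≡_ (λ {π} π↭ → π , π↭ , refl) (λ { _ _ _ refl refl → refl })
    (λ { π↭ _ refl → occ≡ π↭ }) k

-- The sentinel n + 1 plays the role of the left-to-right minimum of the empty prefix.
sentinel-drop : ∀ {n x q} → x ≤ n → Refines x (suc n ∷ q) q
sentinel-drop x≤n (here refl) 1+n<x = ⊥-elim (<-asym 1+n<x (s≤s x≤n))
sentinel-drop x≤n (there i∈q) _     = _ , i∈q , ≤-refl

-- Before anything is read every value counts as lower, so the first entry is copied.
FlipPerm : ℕ → List ℕ → List ℕ → Set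
FlipPerm n = Flip (positions n) [] []

-- The sentinel gives the initial state the shape `L ++ m ∷ U` with `U` empty.
positions-sorted : ∀ n → Sorted (positions n ++ suc n ∷ [])
positions-sorted n = AllPairs.++⁺ (AllPairs.map⁺ (AllPairs.applyUpTo⁺₁ id n (λ i<j _ → s≤s i<j)))
  ([] ∷ []) (All.tabulate λ k∈ → s≤s (proj₂ (∈-positions⁻ k∈)) ∷ [])

module _ {n π ρ} (π↭ : Perm n π) (ρ↭ : Perm n ρ) (f : FlipPerm n π ρ) {j} (j∈ : j ∈[1⋯ n ]) where

  private
    module π = Split (splitPerm π↭ j∈)
    module ρ = Split (splitPerm ρ↭ j∈)

    length≡ : length π.before ≡ length ρ.before
    length≡ = suc-injective (trans π.length-before (sym ρ.length-before))

  FlipPerm-Occ₄⇒Occ₁₂ : ∀ {i} → Occ R₄ n π i j → ∃ λ i′ → Occ R₁₂ n ρ i′ j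
  FlipPerm-Occ₄⇒Occ₁₂ o = greatest⇒Occ₁₂ ρ↭ j∈ (GreatestAbove-resp (sentinel-drop (proj₂ (at-range ρ↭ j∈)))
    (flip-least⇒greatest (positions-sorted n) (positions-sorted n) f π.before ρ.before π.split ρ.split length≡
      (LeastAbove-resp (Refines-⊆ there) (sentinel-drop (proj₂ (at-range π↭ j∈))) (Occ₄⇒least π↭ j∈ o))))

  FlipPerm-Occ₁₂⇒Occ₄ : ∀ {i} → Occ R₁₂ n ρ i j → ∃ λ i′ → Occ R₄ n π i′ j
  FlipPerm-Occ₁₂⇒Occ₄ o = least⇒Occ₄ π↭ j∈
    (LeastAbove-resp (sentinel-drop (proj₂ (at-range π↭ j∈))) (Refines-⊆ there)
      (flip-greatest⇒least (positions-sorted n) (positions-sorted n) f π.before ρ.before π.split ρ.split length≡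
        (GreatestAbove-resp (Refines-⊆ there) (Occ⇒greatest ρ↭ j∈ (here refl) o))))

FlipPerm-occ : ∀ {n π ρ} → Perm n π → Perm n ρ → FlipPerm n π ρ → occ R₄ π ≡ occ R₁₂ ρ
FlipPerm-occ π↭ ρ↭ f = ≤-antisym
  (occ-≤-same-top π↭ ρ↭ (λ o → FlipPerm-Occ₄⇒Occ₁₂ π↭ ρ↭ f (Occ.j∈ o) o)
    (Occ-unique-min π↭ (there (there (here refl))) (there (here refl))))
  (occ-≤-same-top ρ↭ π↭ (λ o → FlipPerm-Occ₁₂⇒Occ₄ π↭ ρ↭ f (Occ.j∈ o) o)
    (Occ-unique-min ρ↭ (there (here refl)) (there (there (here refl)))))

flipPerm : ∀ {n π} → Perm n π → ∃ λ ρ → Perm n ρ × FlipPerm n π ρ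
flipPerm {n} {π} π↭
  with ρ , f ← flip-total π {U = []} {[]} (subst (π ↭_) (sym (++-identityʳ (positions n))) π↭) refl =
  ρ , subst (ρ ↭_) (++-identityʳ (positions n)) (Flip⇒↭ (Flip-sym f)) , f

FlipPerm-functional : ∀ {n π ρ ρ′} → FlipPerm n π ρ → FlipPerm n π ρ′ → ρ ≡ ρ′
FlipPerm-functional {n} f f′ = flip-functional
  (subst Unique (sym (++-identityʳ (positions n))) (positions-unique n)) f f′ refl refl refl refl

-- Rank reversal is an involution: by `Flip-sym` one relation serves both inequalities, and its
-- functionality is also its injectivity.
equidistributed-flip : Equidistributed R₄ R₁₂
equidistributed-flip n k = ≤-antisym
  (s-≤ (FlipPerm n) flipPerm
    (λ _ _ _ f f′ → FlipPerm-functional (Flip-sym f) (Flip-sym f′)) FlipPerm-occ k)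
  (s-≤ (FlipPerm n) flipPerm
    (λ _ _ _ f f′ → FlipPerm-functional (Flip-sym f) (Flip-sym f′))
    (λ π↭ ρ↭ f → sym (FlipPerm-occ ρ↭ π↭ (Flip-sym f))) k)

-- Assembling the twelve patterns.

module _ (σ : Box → Box) where
  open DecMembership (×-≡-dec (Fin._≟_ {3}) (Fin._≟_ {3})) using (_∈?_)

  -- For concrete patterns the decision evaluates and `True` becomes the unit type, so the implicit
  -- proofs in `byRotation` and `byTransposition` are filled in automatically.
  Maps : List Box → List Box → Set
  Maps R S = True (all? (λ b → σ b ∈? S) R)

  Maps⇒∈ : ∀ {R S} → Maps R S → ∀ {b} → b ∈ R → σ b ∈ S
  Maps⇒∈ R→S = All.lookup (toWitness R→S)

rotate transpose : Box → Box
rotate (a , b)    = opposite a , opposite b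
transpose (a , b) = b , a

byRotation : ∀ {R S} {_ : Maps rotate R S} {_ : Maps rotate S R} → Equidistributed R S
byRotation {R} {S} {p} {q} = equidistributed-reverseComplement
  (Maps⇒∈ rotate {R} {S} p) (Maps⇒∈ rotate {S} {R} q)

byTransposition : ∀ {R S} {_ : Maps transpose R S} {_ : Maps transpose S R} → Equidistributed R S
byTransposition {R} {S} {p} {q} = equidistributed-inverse
  (Maps⇒∈ transpose {R} {S} p) (Maps⇒∈ transpose {S} {R} q)

infixr 6 _⨾_

_⨾_ : ∀ {R S Q} → Equidistributed R S → Equidistributed S Q → Equidistributed R Q
(e ⨾ e′) n k = trans (e n k) (e′ n k)

-- The orbits under the symmetries are the places 1 to 4, 5 to 8 and 9 to 12, represented by `R₄`,
-- `R₅` and `R₁₂`. The first is joined to the last by rank reversal, the second by the equality of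
-- occurrence counts.
twelve-equidistributed : All (λ R → Equidistributed R R₁₂) twelve
twelve-equidistributed =
    R₁~R₁₂
  ∷ byTransposition ⨾ equidistributed-flip
  ∷ byTransposition ⨾ R₁~R₁₂
  ∷ equidistributed-flip
  ∷ R₅~R₁₂
  ∷ byRotation ⨾ R₈~R₁₂
  ∷ byRotation ⨾ R₅~R₁₂
  ∷ R₈~R₁₂
  ∷ R₉~R₁₂
  ∷ byTransposition
  ∷ byTransposition ⨾ R₉~R₁₂
  ∷ (λ _ _ → refl)
  ∷ []
  where
  R₁~R₁₂ : Equidistributed ((b1 , b2) ∷ (b2 , b2) ∷ (b0 , b1) ∷ []) R₁₂
  R₁~R₁₂ = byRotation ⨾ equidistributed-flip

  R₅~R₁₂ : Equidistributed R₅ R₁₂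
  R₅~R₁₂ = equidistributed-occ≡ occ₅≡occ₁₂

  R₈~R₁₂ : Equidistributed ((b2 , b2) ∷ (b1 , b1) ∷ (b1 , b0) ∷ []) R₁₂
  R₈~R₁₂ = byTransposition ⨾ R₅~R₁₂

  R₉~R₁₂ : Equidistributed ((b1 , b2) ∷ (b2 , b2) ∷ (b0 , b0) ∷ []) R₁₂
  R₉~R₁₂ = byRotation

theorem6p4 : ∀ {R₁ R₂ : List Box} → R₁ ∈ twelve → R₂ ∈ twelve → Equidistributed R₁ R₂
theorem6p4 R₁∈ R₂∈ n k =
  trans (All.lookup twelve-equidistributed R₁∈ n k) (sym (All.lookup twelve-equidistributed R₂∈ n k))
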